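{- Let $r\ge1$, let $b_1\ge\cdots\ge b_r$ be integers with $b_i\ge i$ for all $i$, let $M=b_1-1$, and let $u_1,\dots,u_M$ be commuting indeterminates. For $0\le j\le M$, $(i,c)\in F_{\mathbf b}$ and $\sigma\in\{\varnothing,L,R\}$ (recording the previous move), define polynomials $G_j(i,c;\sigma)$ recursively: $G_0(i,i;\varnothing)=1$ for $1\le i\le r$ and all other values $G_0(\cdot)$ are $0$; and for $1\le j\le M$ the polynomials $G_j$ start at $0$ and are accumulated through the following transitions, over all $(i,c)\in F_{\mathbf b}$ and all $\sigma\in\{\varnothing,L,R\}$: - if $(i-1,c)\in F_{\mathbf b}$, add $G_{j-1}(i,c;\sigma)\cdot u_j^{\epsilon(\sigma)}$ to $G_j(i-1,c;L)$, where $\epsilon(\sigma)=1$ if $\sigma\in\{\varnothing,R\}$ and $\epsilon(\sigma)=0$ if $\sigma=L$; - if $(i,c+1)\in F_{\mathbf b}$, add $G_{j-1}(i,c;\sigma)$ to $G_j(i,c+1;R)$. Then $$\mathcal D_{\mathbf b}(\mathbf u)=\sum_{\sigma\in\{\varnothing,L,R\}}G_M(1,b_1;\sigma).$$ In particular, the complete multivariate enumerator $\mathcal D_{\mathbf b}(\mathbf u)$, and hence the $q$-Zeta numerator $\mathbb{H}_{F_{\mathbf b},\rho}(q,t)=\mathcal D_{\mathbf b}(t,tq,\dots,tq^{M-1})$, is computable with $O(M\,|F_{\mathbf b}|)$ polynomial-ring transitions.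
   Context: Ferrers-cell poset: $F_{\mathbf b}=\{(i,c):1\le i\le r,\ i\le c\le b_i\}$, ordered by $(i,c)\le(j,d)\iff i\ge j$ and $c\le d$, with rank $\rho(i,c)=c-i$. Words: for $w\in\{L,R\}^M$ let $\ell(w)$ be its number of $L$'s and $\iota(w)=\ell(w)+1$. $\mathcal W_{\mathbf b}$ is the set of $w\in\{L,R\}^M$ with $\ell(w)\le r-1$ such that for every prefix, with $L_k$ letters $L$ and $R_k$ letters $R$, $\iota(w)+R_k\le b_{\iota(w)-L_k}$. $D(w)=\{j: w_j=L\text{ and }(j=1\text{ or }w_{j-1}=R)\}$. The multivariate descent enumerator is $\mathcal D_{\mathbf b}(\mathbf u)=\sum_{w\in\mathcal W_{\mathbf b}}\prod_{j\in D(w)}u_j$. $q$-Zeta numerator: for a finite graded poset $P$ with unique maximum and rank function $\rho:P\to\{0,\dots,H\}$ ($H$ the maximal rank), put $A_m(P,\rho;q)=\sum_{x_1\le\cdots\le x_m}q^{\rho(x_1)+\cdots+\rho(x_m)}$ ($A_0=1$); $\mathbb{H}_{P,\rho}(q,t)$ is determined by $\sum_{m\ge 0}A_m(P,\rho;q)t^m=\mathbb{H}_{P,\rho}(q,t)/\prod_{a=0}^{H}(1-q^at)$. A "polynomial-ring transition" is one update step of the form displayed in the two bullet points. -}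

module Defs where

open import Algebra.Bundles.Raw using (RawRing)
import Algebra.Definitions.RawSemiring as RawSemiringDefinitions
open import Data.Bool.Base using (if_then_else_)
open import Data.Fin.Base using (Fin; zero; suc; toℕ; pred)
open import Data.Integer.Base as ℤ using (ℤ; 0ℤ; 1ℤ)
open import Data.List.Base
  using (List; []; _∷_; [_]; _++_; map; foldr; foldl; filter; length; inits;
         upTo; allFin; cartesianProduct; cartesianProductWith; concatMap)
open import Data.List.Relation.Unary.All using (All; all?)
open import Data.Maybe.Base using (Maybe; just; nothing)
import Data.Maybe.Properties as Maybe
open import Data.Nat.Base as ℕ using (ℕ; zero; suc; _∸_; _⊔_; _≤_; _≥_)
import Data.Nat.Properties as ℕ
open import Data.Product.Base using (_×_; _,_; proj₁; proj₂)
import Data.Product.Properties as Product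
open import Data.Sum.Base using (_⊎_)
open import Data.Vec.Base as Vec using (Vec; []; _∷_; lookup; toList; zipWith; replicate; _[_]≔_)
open import Data.Vec.Relation.Unary.Linked using (linked?)
import Data.Vec.Properties as Vec
open import Level using (0ℓ)
open import Relation.Binary.Core using (Rel)
open import Relation.Binary.Definitions using (Decidable; DecidableEquality)
open import Relation.Binary.PropositionalEquality using (_≡_; refl)
open import Relation.Nullary.Decidable using (Dec; yes; no; does; _×-dec_; _⊎-dec_)
import Relation.Unary as U

module BigOps {c ℓ} (R : RawRing c ℓ) where
  open RawRing R
  open RawSemiringDefinitions rawSemiring public using (_^_)

  ∑ : {A : Set} → List A → (A → Carrier) → Carrier
  ∑ xs f = foldr (λ x s → f x + s) 0# xs

  ∏ : {A : Set} → List A → (A → Carrier) → Carrier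
  ∏ xs f = foldr (λ x s → f x * s) 1# xs

-- A polynomial over ℤ in n commuting indeterminates is a formal sum of terms
-- (coefficient , exponent vector), possibly with repeated exponent vectors;
-- equality of polynomials is equality of all coefficients.

Poly : ℕ → Set
Poly n = List (ℤ × Vec ℕ n)

coeff : ∀ {n} → Poly n → Vec ℕ n → ℤ
coeff p e =
  foldr ℤ._+_ 0ℤ (map proj₁ (filter (λ term → Vec.≡-dec ℕ._≟_ (proj₂ term) e) p))

const : ∀ {n} → ℤ → Poly n
const {n} a = [ a , replicate n 0 ]

var : ∀ {n} → Fin n → Poly n
var {n} i = [ 1ℤ , replicate n 0 [ i ]≔ 1 ]

polyRing : ℕ → RawRing 0ℓ 0ℓ
polyRing n = record
  { Carrier = Poly n
  ; _≈_     = λ p p′ → ∀ e → coeff p e ≡ coeff p′ e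
  ; _+_     = _++_
  ; _*_     = cartesianProductWith (λ (a , e) (a′ , e′) → a ℤ.* a′ , zipWith ℕ._+_ e e′)
  ; -_      = map (λ (a , e) → ℤ.- a , e)
  ; 0#      = []
  ; 1#      = const 1ℤ
  }

substitute : ∀ {m n} → (Fin n → Poly m) → Poly n → Poly m
substitute {m} {n} f p =
  ∑ p (λ (a , e) → const a * ∏ (allFin n) (λ i → f i ^ lookup e i))
  where
  open RawRing (polyRing m)
  open BigOps (polyRing m)

-- R[[t]], a series being its sequence of coefficients.

seriesRing : ∀ {c ℓ} → RawRing c ℓ → RawRing c ℓ
seriesRing R = record
  { Carrier = ℕ → Carrier
  ; _≈_     = λ f g → ∀ n → f n ≈ g n
  ; _+_     = λ f g n → f n + g n
  ; _*_     = λ f g n → ∑ (upTo (suc n)) (λ k → f k * g (n ∸ k))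
  ; -_      = λ f n → - f n
  ; 0#      = λ _ → 0#
  ; 1#      = λ { zero → 1# ; (suc _) → 0# }
  }
  where
  open RawRing R
  open BigOps R

_t^_ : ∀ {n} → Poly n → ℕ → (ℕ → Poly n)
(c t^ m) k = if does (k ℕ.≟ m) then c else []

-- The embedding ℤ[q,t] ⊆ ℤ[q][[t]]; in ℤ[q,t], q is indeterminate 0 and t is
-- indeterminate 1.

toSeries : Poly 2 → (ℕ → Poly 1)
toSeries p m =
  map (λ { (a , i ∷ _ ∷ []) → a , i ∷ [] })
      (filter (λ (_ , e) → lookup e (suc zero) ℕ.≟ m) p)

-- The monomial t q^(j-1) that specialises u_j.  Throughout, the position j,
-- 1 ≤ j ≤ M, is the element of Fin M whose toℕ is j-1.

tqPower : ∀ {M} → Fin M → Poly 2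
tqPower j = var (suc zero) * var zero ^ toℕ j
  where
  open RawRing (polyRing 2)
  open BigOps (polyRing 2)

tuples : {X : Set} → List X → (n : ℕ) → List (Vec X n)
tuples xs zero    = [ [] ]
tuples xs (suc n) = cartesianProductWith _∷_ xs (tuples xs n)

-- The poset is given by an enumeration of its elements without repetition, its
-- decidable order and its rank function.

module QZeta {X : Set} (elements : List X)
             {_≼_ : Rel X 0ℓ} (_≼?_ : Decidable _≼_) (ρ : X → ℕ) where

  private
    ℤ[q]    = polyRing 1
    ℤ[q][t] = seriesRing ℤ[q]

    q : Poly 1
    q = var zero

  multichains : (m : ℕ) → List (Vec X m)
  multichains m = filter (linked? _≼?_) (tuples elements m)

  A : ℕ → Poly 1
  A m = ∑ (multichains m) (λ x → q ^ Vec.sum (Vec.map ρ x))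
    where open BigOps ℤ[q]

  maxRank : ℕ
  maxRank = foldr _⊔_ 0 (map ρ elements)

  -- Each 1 - q^a t is a unit of ℤ[q][[t]], so that the equation
  -- ∑ₘ Aₘ tᵐ = ℍ / ∏ₐ (1 - q^a t) amounts to ℍ being the following product.

  numerator : ℕ → Poly 1
  numerator = A * ∏ (upTo (suc maxRank)) (λ a → 1# + - ((q ^ a) t^ 1))
    where
    open RawRing ℤ[q][t]
    open BigOps ℤ[q][t] using (∏)
    open BigOps ℤ[q] using (_^_)

-- The sequence b_1, …, b_r is given as a function ℕ → ℕ, of which only the
-- values at 1, …, r are used.

Cell : Set
Cell = ℕ × ℕ

InF : (r : ℕ) (b : ℕ → ℕ) → Cell → Set
InF r b (i , c) = (1 ≤ i × i ≤ r) × (i ≤ c × c ≤ b i)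

inF? : (r : ℕ) (b : ℕ → ℕ) → U.Decidable (InF r b)
inF? r b (i , c) = (1 ℕ.≤? i ×-dec i ℕ.≤? r) ×-dec (i ℕ.≤? c ×-dec c ℕ.≤? b i)

F : (r : ℕ) (b : ℕ → ℕ) → List Cell
F r b = filter (inF? r b)
  (concatMap (λ i → map (i ,_) (upTo (suc (b i)))) (upTo (suc r)))

_≼_ : Rel Cell 0ℓ
(i , c) ≼ (j , d) = i ≥ j × c ≤ d

_≼?_ : Decidable _≼_
(i , c) ≼? (j , d) = j ℕ.≤? i ×-dec c ℕ.≤? d

ρ : Cell → ℕ
ρ (i , c) = c ∸ i

qZetaNumerator : (r : ℕ) (b : ℕ → ℕ) → (ℕ → Poly 1)
qZetaNumerator r b = QZeta.numerator (F r b) _≼?_ ρ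

data Letter : Set where
  L R : Letter

_≟ᴸ_ : DecidableEquality Letter
L ≟ᴸ L = yes refl
L ≟ᴸ R = no λ ()
R ≟ᴸ L = no λ ()
R ≟ᴸ R = yes refl

# : Letter → List Letter → ℕ
# x w = length (filter (_≟ᴸ x) w)

ι : ∀ {M} → Vec Letter M → ℕ
ι w = # L (toList w) ℕ.+ 1

Admissible : (r : ℕ) (b : ℕ → ℕ) {M : ℕ} → Vec Letter M → Set
Admissible r b w =
  # L (toList w) ≤ r ∸ 1 ×
  All (λ p → ι w ℕ.+ # R p ≤ b (ι w ∸ # L p)) (inits (toList w))

admissible? : (r : ℕ) (b : ℕ → ℕ) {M : ℕ} → U.Decidable (Admissible r b {M})
admissible? r b w =
  # L (toList w) ℕ.≤? r ∸ 1 ×-dec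
  all? (λ p → ι w ℕ.+ # R p ℕ.≤? b (ι w ∸ # L p)) (inits (toList w))

words : (r : ℕ) (b : ℕ → ℕ) → List (Vec Letter (b 1 ∸ 1))
words r b = filter (admissible? r b) (tuples (L ∷ R ∷ []) (b 1 ∸ 1))

IsDescent : ∀ {M} → Vec Letter M → Fin M → Set
IsDescent w j = lookup w j ≡ L × (toℕ j ≡ 0 ⊎ lookup w (pred j) ≡ R)

isDescent? : ∀ {M} (w : Vec Letter M) → U.Decidable (IsDescent w)
isDescent? w j =
  lookup w j ≟ᴸ L ×-dec (toℕ j ℕ.≟ 0 ⊎-dec lookup w (pred j) ≟ᴸ R)

descents : ∀ {M} → Vec Letter M → List (Fin M)
descents {M} w = filter (isDescent? w) (allFin M)

descentEnumerator : (r : ℕ) (b : ℕ → ℕ) → Poly (b 1 ∸ 1)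
descentEnumerator r b = ∑ (words r b) (λ w → ∏ (descents w) var)
  where open BigOps (polyRing (b 1 ∸ 1))

-- nothing stands for the previous move ∅.

Previous : Set
Previous = Maybe Letter

previousMoves : List Previous
previousMoves = nothing ∷ just L ∷ just R ∷ []

ε : Previous → ℕ
ε nothing  = 1
ε (just R) = 1
ε (just L) = 0

-- (j , (i , c) , σ) is the index of the polynomial G_j(i,c;σ).

Index : Set
Index = ℕ × Cell × Previous

_≟ᴵ_ : DecidableEquality Index
_≟ᴵ_ = Product.≡-dec ℕ._≟_ (Product.≡-dec (Product.≡-dec ℕ._≟_ ℕ._≟_) (Maybe.≡-dec _≟ᴸ_))

move : Letter → Cell → Cell
move L (i , c) = i ∸ 1 , c
move R (i , c) = i , suc c

-- (j , (i , c) , σ , x) is the transition that, for the move x, adds to an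
-- entry of G_j a contribution of G_{j-1}(i,c;σ).

Transition : ℕ → Set
Transition M = Fin M × Cell × Previous × Letter

-- Listed by increasing j.  No target i ∸ 1 is affected by the
-- truncation, since (0 , c) is not in F.

transitions : (r : ℕ) (b : ℕ → ℕ) → List (Transition (b 1 ∸ 1))
transitions r b = filter (λ (_ , x , _ , m) → inF? r b (move m x))
  (cartesianProduct (allFin (b 1 ∸ 1))
    (cartesianProduct (F r b) (cartesianProduct previousMoves (L ∷ R ∷ []))))

module Recursion {c ℓ} (S : RawRing c ℓ) (r : ℕ) (b : ℕ → ℕ)
                 (u : Fin (b 1 ∸ 1) → RawRing.Carrier S) where
  open RawRing S
  open BigOps S

  Table : Set c
  Table = Index → Carrier

  initial : Table
  initial (zero , (i , c) , nothing) =
    if does (i ℕ.≟ c ×-dec (1 ℕ.≤? i ×-dec i ℕ.≤? r)) then 1# else 0#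
  initial _ = 0#

  add : Index → Carrier → Table → Table
  add k v T k′ = if does (k ≟ᴵ k′) then T k′ + v else T k′

  weight : Fin (b 1 ∸ 1) → Previous → Letter → Carrier → Carrier
  weight j σ L v = v * u j ^ ε σ
  weight j σ R v = v

  apply : Table → Transition (b 1 ∸ 1) → Table
  apply T (j , x , σ , m) =
    add (suc (toℕ j) , move m x , just m) (weight j σ m (T (toℕ j , x , σ))) T

  -- The final contents of the table.  G_{j-1} is complete before it is first
  -- read, because the transitions are applied by increasing j.

  G : Table
  G = foldl apply initial (transitions r b)

  result : Carrier
  result = ∑ previousMoves (λ σ → G (b 1 ∸ 1 , (1 , b 1) , σ))

{-# OPTIONS --safe #-}

-- A word is a maximal chain of F, so that cutting it at its first letter gives a
-- backward recursion for the sum of the descent weights over all words leading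
-- from a cell to the top (pathSum).  The table G satisfies the adjoint, forward
-- recursion, whence ∑ G_l(x;σ) · pathSum(x;σ) does not depend on l.
--
-- For the numerator, let V x be the generating function of the multichains above
-- x, let T i c be that of the multichains whose least element lies in row i from
-- column c on (with the empty one if i = 1), and let z_a = q^a t.  Then, for
-- x = (i , c) of rank k,
--   V x   = V (i-1 , c) + T i c,
--   T i c = z_k V x + T i (c+1),
-- and these turn into the recursion of pathSum once multiplied by
-- ∏_{a ≥ k} (1 - z_a): after a move L, pathSum is this product times V x, and
-- after a move R, or at the start, it is this product times T i c.

module Submission where

open import Defs
open import Algebra.Bundles using (CommutativeRing)
open import Algebra.Bundles.Raw using (RawRing)
import Algebra.Properties.CommutativeSemigroup as CommutativeSemigroupProperties
import Algebra.Properties.Group as GroupProperties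
import Algebra.Solver.Ring.NaturalCoefficients.Default as Solver
open import Algebra.Structures using (IsAbelianGroup; IsCommutativeRing)
open import Data.Bool.Base using (true; false; if_then_else_)
open import Data.Fin.Base using (Fin; zero; suc; toℕ; inject₁)
open import Data.Integer.Base as ℤ using (ℤ; 0ℤ; 1ℤ)
import Data.Integer.Properties as ℤ
open import Data.Integer.Tactic.RingSolver using (solve-∀)
open import Data.List.Base as List
  using (List; []; _∷_; _++_; map; filter; foldr; foldl; length; inits; upTo; applyUpTo;
         allFin; tabulate; concatMap; cartesianProduct; cartesianProductWith)
open import Data.List.Membership.Propositional using (_∈_)
import Data.List.Membership.Propositional.Properties as ∈
import Data.List.Properties as List
open import Data.List.Relation.Unary.All as All using (All; []; _∷_)
import Data.List.Relation.Unary.All.Properties as All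
open import Data.List.Relation.Unary.Any as Any using (here; there)
open import Data.Maybe.Base using (just; nothing)
import Data.Maybe.Properties as Maybe
open import Data.Nat.Base as Nat
  using (ℕ; zero; suc; _∸_; _⊔_; _≤_; _<_; z≤n; s≤s; z<s; s<s)
import Data.Nat.Properties as ℕ
open import Data.Product.Base using (Σ; _×_; _,_; proj₁; proj₂)
import Data.Product.Properties as Product
open import Data.Sum.Base using (_⊎_; inj₁; inj₂)
open import Data.Vec.Base as Vec using
  (Vec; []; _∷_; lookup; toList; zipWith; replicate; _[_]≔_)
import Data.Vec.Properties as Vec
open import Data.Vec.Relation.Unary.Linked using (Linked; linked?)
open import Function.Base using (_∘_; id)
open import Level using (0ℓ)
open import Relation.Binary.Core using (Rel)
open import Relation.Binary.Definitions using (DecidableEquality)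
open import Relation.Binary.PropositionalEquality as ≡ using (_≡_; _≢_)
open import Relation.Nullary using (¬_; contradiction)
open import Relation.Nullary.Decidable using (Dec; yes; no; does; _×-dec_)
import Relation.Unary as U

-- The equality may differ from that of R: polynomials are compared below by an
-- equality finer than equality of coefficients.

-- For x = (i , c) of rank k, eliminating the term z_k V x gives (1 - z_k) V x = V (i-1 , c) + T i
-- (c+1), (1 - z_k) T i c = z_k V (i-1 , c) + T i (c+1). The two differ only in the coefficient 1 or
-- z_k of V (i-1 , c), just as the weight of an `L` depends on the letter before it. Every move
-- raises the rank by one, so letter j is read at rank j - 1 and u_j has to become z_(j-1). A path
-- from rank k has M - k letters, whereas the product has M - k + 1 factors: the surplus one, 1 -
-- z_M, is absorbed at the top, the only cell of rank M. The starting cells are the (i , i), and the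
-- series T i i together count every multichain once. The obstacle is that ℤ[u], ℤ[q,t] and
-- ℤ[q][[t]] have to be compared. Path sums are therefore treated over an arbitrary commutative ring
-- and then transported. They are built by addition and by multiplication with single weights, so an
-- additive map need only respect these multiplications; substitution and the passage to series are
-- never shown to be ring homomorphisms.

record CommutativeRingOn {c ℓ} (R : RawRing c ℓ) : Set (c Level.⊔ Level.suc ℓ) where
  open RawRing R using (Carrier; _+_; _*_; -_; 0#; 1#)
  field
    _≈_               : Rel Carrier ℓ
    isCommutativeRing : IsCommutativeRing _≈_ _+_ _*_ -_ 0# 1#

  commutativeRing : CommutativeRing c ℓ
  commutativeRing = record { isCommutativeRing = isCommutativeRing }

-- Finite sums and indicators

module Sums {c ℓ} {S : RawRing c ℓ} (E : CommutativeRingOn S) where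
  open CommutativeRing (CommutativeRingOn.commutativeRing E) public hiding (zero)
  open BigOps S public using (∏; _^_)
  open import Relation.Binary.Reasoning.Setoid setoid public

  private
    module + = CommutativeSemigroupProperties +-commutativeSemigroup

    variable
      X Y Z : Set
      P Q : Set

  -- Sums and indicators are opaque so that their arguments can be inferred even
  -- when the list or the decision procedure computes.

  opaque
    ∑ : List X → (X → Carrier) → Carrier
    ∑ = BigOps.∑ S

    when : Dec P → Carrier → Carrier
    when P? x = if does P? then x else 0#

    ∑-def : {xs : List X} {f : X → Carrier} → BigOps.∑ S xs f ≡ ∑ xs f
    ∑-def = ≡.refl

    if≡when : (P? : Dec P) {x : Carrier} → (if does P? then x else 0#) ≡ when P? x
    if≡when _ = ≡.refl

    ∑-[] : {f : X → Carrier} → ∑ [] f ≡ 0#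
    ∑-[] = ≡.refl

    ∑-∷ : {x : X} {xs : List X} {f : X → Carrier} → ∑ (x ∷ xs) f ≡ f x + ∑ xs f
    ∑-∷ = ≡.refl

    when-true : (P? : Dec P) {x : Carrier} → P → when P? x ≈ x
    when-true (yes _) _ = refl
    when-true (no ¬p) p = contradiction p ¬p

    when-false : (P? : Dec P) {x : Carrier} → ¬ P → when P? x ≈ 0#
    when-false (yes p) ¬p = contradiction p ¬p
    when-false (no _)  _  = refl

    -- The values have to agree only where the condition holds, so a summand can be rewritten using,
    -- for example, its membership in `F`.
    when-⇔ : (P? : Dec P) (Q? : Dec Q) {x y : Carrier} →
             (P → Q) → (Q → P) → (P → x ≈ y) → when P? x ≈ when Q? y
    when-⇔ (yes p) Q? f _ x≈y = trans (x≈y p) (sym (when-true Q? (f p)))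
    when-⇔ (no ¬p) Q? _ g _   = sym (when-false Q? (¬p ∘ g))

    when-cong : (P? : Dec P) {x y : Carrier} → (P → x ≈ y) → when P? x ≈ when P? y
    when-cong P? = when-⇔ P? P? id id

    when-× : (P? : Dec P) (Q? : Dec Q) {x : Carrier} →
             when (P? ×-dec Q?) x ≈ when P? (when Q? x)
    when-× (yes _) _ = refl
    when-× (no _)  _ = refl

    when-0# : (P? : Dec P) → when P? 0# ≈ 0#
    when-0# (yes _) = refl
    when-0# (no _)  = refl

    *-when : (P? : Dec P) {x y : Carrier} → x * when P? y ≈ when P? (x * y)
    *-when (yes _) = refl
    *-when (no _)  = zeroʳ _

    when-* : (P? : Dec P) {x y : Carrier} → when P? x * y ≈ when P? (x * y)
    when-* (yes _) = refl
    when-* (no _)  = zeroˡ _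

    ∑-cong : (xs : List X) {f g : X → Carrier} → (∀ x → f x ≈ g x) → ∑ xs f ≈ ∑ xs g
    ∑-cong []       f≈g = refl
    ∑-cong (x ∷ xs) f≈g = +-cong (f≈g x) (∑-cong xs f≈g)

    ∑-0# : (xs : List X) {f : X → Carrier} → (∀ x → f x ≈ 0#) → ∑ xs f ≈ 0#
    ∑-0# []       f≈0 = refl
    ∑-0# (x ∷ xs) f≈0 = trans (+-cong (f≈0 x) (∑-0# xs f≈0)) (+-identityˡ 0#)

    ∑-++ : (xs ys : List X) {f : X → Carrier} → ∑ (xs ++ ys) f ≈ ∑ xs f + ∑ ys f
    ∑-++ []       ys = sym (+-identityˡ _)
    ∑-++ (x ∷ xs) ys = trans (+-congˡ (∑-++ xs ys)) (sym (+-assoc _ _ _))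

    ∑-map : (h : X → Y) (xs : List X) {f : Y → Carrier} → ∑ (map h xs) f ≈ ∑ xs (f ∘ h)
    ∑-map h []       = refl
    ∑-map h (x ∷ xs) = +-congˡ (∑-map h xs)

    ∑-+ : (xs : List X) {f g : X → Carrier} → ∑ xs (λ x → f x + g x) ≈ ∑ xs f + ∑ xs g
    ∑-+ []       = sym (+-identityˡ 0#)
    ∑-+ (x ∷ xs) = trans (+-congˡ (∑-+ xs)) (+.interchange _ _ _ _)

    *-∑ : (a : Carrier) (xs : List X) {f : X → Carrier} → a * ∑ xs f ≈ ∑ xs (λ x → a * f x)
    *-∑ a []       = zeroʳ a
    *-∑ a (x ∷ xs) = trans (distribˡ a _ _) (+-congˡ (*-∑ a xs))

    ∑-* : (xs : List X) {f : X → Carrier} (a : Carrier) → ∑ xs f * a ≈ ∑ xs (λ x → f x * a)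
    ∑-* []       a = zeroˡ a
    ∑-* (x ∷ xs) a = trans (distribʳ a _ _) (+-congˡ (∑-* xs a))

    when-∑ : (P? : Dec P) (xs : List X) {f : X → Carrier} →
             when P? (∑ xs f) ≈ ∑ xs (λ x → when P? (f x))
    when-∑ (yes _) xs = refl
    when-∑ (no _)  xs = sym (∑-0# xs λ _ → refl)

    ∑-swap : (xs : List X) (ys : List Y) {f : X → Y → Carrier} →
             ∑ xs (λ x → ∑ ys (f x)) ≈ ∑ ys (λ y → ∑ xs (λ x → f x y))
    ∑-swap []       ys = sym (∑-0# ys λ _ → refl)
    ∑-swap (x ∷ xs) ys = trans (+-congˡ (∑-swap xs ys)) (sym (∑-+ ys))

    ∑-filter : {P : U.Pred X 0ℓ} (P? : U.Decidable P) (xs : List X) {f : X → Carrier} →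
               ∑ (filter P? xs) f ≈ ∑ xs (λ x → when (P? x) (f x))
    ∑-filter P? [] = refl
    ∑-filter P? (x ∷ xs) with does (P? x)
    ... | true  = +-congˡ (∑-filter P? xs)
    ... | false = trans (∑-filter P? xs) (sym (+-identityˡ _))

    ∑-concatMap : (h : X → List Y) (xs : List X) {f : Y → Carrier} →
                  ∑ (concatMap h xs) f ≈ ∑ xs (λ x → ∑ (h x) f)
    ∑-concatMap h []       = refl
    ∑-concatMap h (x ∷ xs) = trans (∑-++ (h x) _) (+-congˡ (∑-concatMap h xs))

    ∑-cartesianProductWith : (h : X → Y → Z) (xs : List X) (ys : List Y) {f : Z → Carrier} →
      ∑ (cartesianProductWith h xs ys) f ≈ ∑ xs (λ x → ∑ ys (λ y → f (h x y)))
    ∑-cartesianProductWith h []       ys = refl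
    ∑-cartesianProductWith h (x ∷ xs) ys =
      trans (∑-++ (map (h x) ys) _) (+-cong (∑-map (h x) ys) (∑-cartesianProductWith h xs ys))

    ∑-applyUpTo : (h : ℕ → X) (n : ℕ) {f : X → Carrier} → ∑ (applyUpTo h n) f ≡
      ∑ (upTo n) (f ∘ h)
    ∑-applyUpTo h zero = ≡.refl
    ∑-applyUpTo h (suc n) {f} = ≡.cong (f (h zero) +_)
      (≡.trans (∑-applyUpTo (h ∘ suc) n) (≡.sym (∑-applyUpTo suc n)))

    ∑-upTo-suc : (n : ℕ) {f : ℕ → Carrier} → ∑ (upTo (suc n)) f ≡ f 0 + ∑ (upTo n) (f ∘ suc)
    ∑-upTo-suc n {f} = ≡.cong (f 0 +_) (∑-applyUpTo suc n)

    ∑-upTo-cong : (n : ℕ) {f g : ℕ → Carrier} → (∀ k → k < n → f k ≈ g k) →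
                  ∑ (upTo n) f ≈ ∑ (upTo n) g
    ∑-upTo-cong zero    f≈g = refl
    ∑-upTo-cong (suc n) {f} {g} f≈g = begin
      ∑ (upTo (suc n)) f           ≡⟨ ∑-upTo-suc n ⟩
      f 0 + ∑ (upTo n) (f ∘ suc)
        ≈⟨ +-cong (f≈g 0 z<s) (∑-upTo-cong n λ k k<n → f≈g (suc k) (s<s k<n)) ⟩
      g 0 + ∑ (upTo n) (g ∘ suc)   ≡⟨ ∑-upTo-suc n ⟨
      ∑ (upTo (suc n)) g           ∎

    ∑-upTo-delta : {n k : ℕ} {f : ℕ → Carrier} → k < n →
                   ∑ (upTo n) (λ i → when (i ℕ.≟ k) (f i)) ≈ f k
    ∑-upTo-delta {suc n} {zero} {f} _ = begin
      ∑ (upTo (suc n)) (λ i → when (i ℕ.≟ 0) (f i))  ≡⟨ ∑-upTo-suc n ⟩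
      f 0 + ∑ (upTo n) (λ _ → 0#)                    ≈⟨ +-congˡ (∑-0# (upTo n) λ _ → refl) ⟩
      f 0 + 0#                                       ≈⟨ +-identityʳ _ ⟩
      f 0                                            ∎
    ∑-upTo-delta {suc n} {suc k} {f} (s<s k<n) = begin
      ∑ (upTo (suc n)) (λ i → when (i ℕ.≟ suc k) (f i))      ≡⟨ ∑-upTo-suc n ⟩
      0# + ∑ (upTo n) (λ i → when (i ℕ.≟ k) (f (suc i)))     ≈⟨ +-identityˡ _ ⟩
      ∑ (upTo n) (λ i → when (i ℕ.≟ k) (f (suc i)))          ≈⟨ ∑-upTo-delta k<n ⟩
      f (suc k)                                              ∎

-- Path sums

_≟ᶜ_ : DecidableEquality Cell
_≟ᶜ_ = Product.≡-dec ℕ._≟_ ℕ._≟_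

_≟ᴾ_ : DecidableEquality Previous
_≟ᴾ_ = Maybe.≡-dec _≟ᴸ_

module PathSums {c ℓ} {S : RawRing c ℓ} (E : CommutativeRingOn S) (r : ℕ) (b : ℕ → ℕ) where
  open Sums E

  ∑-F : {f : Cell → Carrier} → ∑ (F r b) f ≈
    ∑ (upTo (suc r)) (λ i → ∑ (upTo (suc (b i))) (λ c → when (inF? r b (i , c)) (f (i , c))))
  ∑-F = trans
    (∑-filter (inF? r b) (concatMap (λ i → map (i ,_) (upTo (suc (b i)))) (upTo (suc r))))
    (trans (∑-concatMap (λ i → map (i ,_) (upTo (suc (b i)))) (upTo (suc r)))
    (∑-cong (upTo (suc r)) λ i → ∑-map (i ,_) (upTo (suc (b i)))))

  -- This is where it matters that `F r b` lists no cell twice.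
  ∑-F-delta : {x : Cell} {f : Cell → Carrier} → InF r b x →
              ∑ (F r b) (λ y → when (y ≟ᶜ x) (f y)) ≈ f x
  ∑-F-delta {x@(i , c)} {f} x∈F@((_ , i≤r) , (_ , c≤b)) = begin
    ∑ (F r b) (λ y → when (y ≟ᶜ x) (f y))                         ≈⟨ ∑-F ⟩
    ∑ (upTo (suc r)) (λ j → ∑ (upTo (suc (b j))) (λ d →
      when (inF? r b (j , d)) (when ((j , d) ≟ᶜ x) (f (j , d)))))
      ≈⟨ ∑-cong (upTo (suc r)) (λ j → ∑-cong (upTo (suc (b j))) (entry j)) ⟩
    ∑ (upTo (suc r))
      (λ j → ∑ (upTo (suc (b j))) (λ d → when (j ℕ.≟ i) (when (d ℕ.≟ c) (f (j , d)))))
      ≈⟨ ∑-cong (upTo (suc r)) (λ j → when-∑ (j ℕ.≟ i) (upTo (suc (b j)))) ⟨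
    ∑ (upTo (suc r))
      (λ j → when (j ℕ.≟ i) (∑ (upTo (suc (b j))) (λ d → when (d ℕ.≟ c) (f (j , d)))))
      ≈⟨ ∑-upTo-delta (s≤s i≤r) ⟩
    ∑ (upTo (suc (b i))) (λ d → when (d ℕ.≟ c) (f (i , d)))
      ≈⟨ ∑-upTo-delta (s≤s c≤b) ⟩
    f x                                                           ∎
    where
    entry : ∀ j d → when (inF? r b (j , d)) (when ((j , d) ≟ᶜ x) (f (j , d))) ≈
                    when (j ℕ.≟ i) (when (d ℕ.≟ c) (f (j , d)))
    entry j d = trans (sym (when-× (inF? r b (j , d)) ((j , d) ≟ᶜ x)))
      (trans (when-⇔ (inF? r b (j , d) ×-dec ((j , d) ≟ᶜ x)) (j ℕ.≟ i ×-dec d ℕ.≟ c)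
               (λ { (_ , ≡.refl) → ≡.refl , ≡.refl })
               (λ { (≡.refl , ≡.refl) → x∈F , ≡.refl })
               (λ _ → refl))
             (when-× (j ℕ.≟ i) (d ℕ.≟ c)))

  ∑-previousMoves : {f : Previous → Carrier} → ∑ previousMoves f ≈ f nothing +
    (f (just L) + f (just R))
  ∑-previousMoves = trans (reflexive ∑-∷) (+-congˡ (trans (reflexive ∑-∷) (+-congˡ
    (trans (reflexive ∑-∷) (trans (+-congˡ (reflexive ∑-[])) (+-identityʳ _))))))

  -- The weight as a separate multiplier: `weight` acts on a table entry, but the backward recursion
  -- has to attach the same factor to the sum over the remaining letters.
  factor : Carrier → Previous → Letter → Carrier
  factor a (just L) L = 1#
  factor a (just R) L = a
  factor a nothing  L = a
  factor a σ        R = 1#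

  top : Cell
  top = 1 , b 1

  -- `u` holds the weights of the letters still to come, so `u zero` always belongs to the next
  -- letter and no position has to be carried along.
  pathSum : ∀ {n} → (Fin n → Carrier) → Cell → Previous → Carrier
  pathSum {zero}  u x σ = when (x ≟ᶜ top) 1#
  pathSum {suc n} u x σ = ∑ (L ∷ R ∷ []) λ m →
    when (inF? r b (move m x)) (pathSum (u ∘ suc) (move m x) (just m) * factor (u zero) σ m)

  totalPathSum : ∀ {n} → (Fin n → Carrier) → Carrier
  totalPathSum u = ∑ (upTo r) (λ i → pathSum u (suc i , suc i) nothing)

-- Dynamic programming

module DynamicProgramming {c ℓ} {S : RawRing c ℓ} (E : CommutativeRingOn S) (r : ℕ) (b : ℕ → ℕ)
    (u : Fin (b 1 ∸ 1) → RawRing.Carrier S) where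
  open Sums E
  open PathSums E r b
  open Recursion S r b u

  Step : Set
  Step = Cell × Previous × Letter

  steps : List Step
  steps = cartesianProduct (F r b) (cartesianProduct previousMoves (L ∷ R ∷ []))

  legal? : (t : Transition (b 1 ∸ 1)) →
    Dec (InF r b (move (proj₂ (proj₂ (proj₂ t))) (proj₁ (proj₂ t))))
  legal? (_ , x , _ , m) = inF? r b (move m x)

  -- Testing legality during the fold, instead of filtering beforehand, leaves the list of
  -- transitions a cartesian product, which splits into one stage for each j.
  applyLegal : Table → Transition (b 1 ∸ 1) → Table
  applyLegal T t = if does (legal? t) then apply T t else T

  foldl-legal : ∀ T ts → foldl apply T (filter legal? ts) ≡ foldl applyLegal T ts
  foldl-legal T [] = ≡.refl
  foldl-legal T (t ∷ ts) with does (legal? t)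
  ... | true  = foldl-legal (apply T t) ts
  ... | false = foldl-legal T ts

  -- The pairing of layer `l` with a function on states. Table and function are arbitrary because
  -- the pairing is also followed through the middle of a stage.
  potential : ℕ → Table → (Cell → Previous → Carrier) → Carrier
  potential l T g = ∑ (F r b) (λ x → ∑ previousMoves (λ σ → T (l , x , σ) * g x σ))

  contribution : Fin (b 1 ∸ 1) → Table → (Cell → Previous → Carrier) → Step → Carrier
  contribution j T g (x , σ , m) = when (inF? r b (move m x))
    (weight j σ m (T (toℕ j , x , σ)) * g (move m x) (just m))

  add-spec : ∀ k v T k′ → add k v T k′ ≈ T k′ + when (k ≟ᴵ k′) v
  add-spec k v T k′ = by-cases (k ≟ᴵ k′)
    where
    by-cases : ∀ {P : Set} (P? : Dec P) → (if does P? then T k′ + v else T k′) ≈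
      T k′ + when P? v
    by-cases P?@(yes p) = +-congˡ (sym (when-true P? p))
    by-cases P?@(no ¬p) = sym (trans (+-congˡ (when-false P? ¬p)) (+-identityʳ _))

  add-≢ : ∀ k v T {k′} → k ≢ k′ → add k v T k′ ≡ T k′
  add-≢ k v T {k′} k≢k′ with k ≟ᴵ k′
  ... | yes k≡k′ = contradiction k≡k′ k≢k′
  ... | no _     = ≡.refl

  applyLegal-≢ : ∀ T t {l} → suc (toℕ (proj₁ t)) ≢ l → ∀ x σ → applyLegal T t (l , x , σ) ≡
    T (l , x , σ)
  applyLegal-≢ T t@(j , y , τ , m) j≢l x σ with does (legal? t)
  ... | true  = add-≢ (suc (toℕ j) , move m y , just m) _ T (j≢l ∘ ≡.cong proj₁)
  ... | false = ≡.refl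

  ∑-previousMoves-delta : ∀ m {f : Previous → Carrier} →
    ∑ previousMoves (λ σ → when (just m ≟ᴾ σ) (f σ)) ≈ f (just m)
  ∑-previousMoves-delta m {f} = begin
    ∑ previousMoves (λ σ → when (just m ≟ᴾ σ) (f σ))
      ≈⟨ ∑-previousMoves ⟩
    when (just m ≟ᴾ nothing) (f nothing) +
      (when (just m ≟ᴾ just L) (f (just L)) + when (just m ≟ᴾ just R) (f (just R)))
      ≈⟨ trans (+-congʳ (when-false (just m ≟ᴾ nothing) λ ())) (+-identityˡ _) ⟩
    when (just m ≟ᴾ just L) (f (just L)) + when (just m ≟ᴾ just R) (f (just R))
      ≈⟨ pick m ⟩
    f (just m) ∎
    where
    pick : ∀ m → when (just m ≟ᴾ just L) (f (just L)) + when (just m ≟ᴾ just R) (f (just R)) ≈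
      f (just m)
    pick L = trans
      (+-cong (when-true (just L ≟ᴾ just L) ≡.refl)
      (when-false (just L ≟ᴾ just R) λ ())) (+-identityʳ _)
    pick R = trans
      (+-cong (when-false (just R ≟ᴾ just L)
      λ ()) (when-true (just R ≟ᴾ just R) ≡.refl)) (+-identityˡ _)

  -- The pairing is linear in the table. It ranges over `F` only, so the changed entry is noticed
  -- because its cell lies in `F`.
  potential-add : ∀ l y m v T g → InF r b y →
    potential l (add (l , y , just m) v T) g ≈ potential l T g + v * g y (just m)
  potential-add l y m v T g y∈F = begin
    potential l (add k v T) g
      ≈⟨ ∑-cong (F r b) (λ x → ∑-cong previousMoves (λ σ →
           trans (*-congʳ (add-spec k v T (l , x , σ))) (distribʳ _ _ _))) ⟩
    ∑ (F r b)
      (λ x → ∑ previousMoves (λ σ → T (l , x , σ) * g x σ + when (k ≟ᴵ (l , x , σ)) v * g x σ))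
      ≈⟨ ∑-cong (F r b) (λ x → ∑-+ previousMoves) ⟩
    ∑ (F r b) (λ x → ∑ previousMoves (λ σ → T (l , x , σ) * g x σ) +
                     ∑ previousMoves (λ σ → when (k ≟ᴵ (l , x , σ)) v * g x σ))
      ≈⟨ ∑-+ (F r b) ⟩
    potential l T g + ∑ (F r b)
      (λ x → ∑ previousMoves (λ σ → when (k ≟ᴵ (l , x , σ)) v * g x σ))
      ≈⟨ +-congˡ (∑-cong (F r b) (λ x → ∑-cong previousMoves (entry x))) ⟩
    potential l T g + ∑ (F r b)
      (λ x → ∑ previousMoves (λ σ → when (x ≟ᶜ y) (when (just m ≟ᴾ σ) (v * g x σ))))
      ≈⟨ +-congˡ (∑-cong (F r b) (λ x → trans (sym (when-∑ (x ≟ᶜ y) previousMoves))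
           (when-cong (x ≟ᶜ y) (λ _ → ∑-previousMoves-delta m)))) ⟩
    potential l T g + ∑ (F r b) (λ x → when (x ≟ᶜ y) (v * g x (just m)))
      ≈⟨ +-congˡ (∑-F-delta y∈F) ⟩
    potential l T g + v * g y (just m)  ∎
    where
    k : Index
    k = l , y , just m

    entry : ∀ x σ → when (k ≟ᴵ (l , x , σ)) v * g x σ ≈
                    when (x ≟ᶜ y) (when (just m ≟ᴾ σ) (v * g x σ))
    entry x σ = trans (when-* (k ≟ᴵ (l , x , σ)))
      (trans (when-⇔ (k ≟ᴵ (l , x , σ)) (x ≟ᶜ y ×-dec just m ≟ᴾ σ)
               (λ { ≡.refl → ≡.refl , ≡.refl }) (λ { (≡.refl , ≡.refl) → ≡.refl }) (λ _ → refl))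
             (when-× (x ≟ᶜ y) (just m ≟ᴾ σ)))

  weight-factor : ∀ j σ m v → weight j σ m v ≈ v * factor (u j) σ m
  weight-factor j (just L) L v = refl
  weight-factor j (just R) L v = *-congˡ (*-identityʳ _)
  weight-factor j nothing  L v = *-congˡ (*-identityʳ _)
  weight-factor j (just L) R v = sym (*-identityʳ v)
  weight-factor j (just R) R v = sym (*-identityʳ v)
  weight-factor j nothing  R v = sym (*-identityʳ v)

  potential-applyLegal : ∀ j t T g →
    potential (suc (toℕ j)) (applyLegal T (j , t)) g ≈ potential (suc (toℕ j)) T g +
      contribution j T g t
  potential-applyLegal j (x , σ , m) T g = by-cases (inF? r b (move m x))
    where
    l = suc (toℕ j)

    by-cases : (legal : Dec (InF r b (move m x))) →
      potential l (if does legal then apply T (j , x , σ , m) else T) g ≈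
      potential l T g + when legal (weight j σ m (T (toℕ j , x , σ)) * g (move m x) (just m))
    by-cases legal@(yes y∈F) = trans (potential-add l (move m x) m _ T g y∈F)
      (+-congˡ (sym (when-true legal y∈F)))
    by-cases legal@(no y∉F)  = sym (trans (+-congˡ (when-false legal y∉F)) (+-identityʳ _))

  -- A stage reads layer `toℕ j` and writes only the next one; hence every contribution can be
  -- computed from the table at the start of the stage.
  potential-stage : ∀ j ts T g →
    potential (suc (toℕ j)) (foldl applyLegal T (map (j ,_) ts)) g ≈
    potential (suc (toℕ j)) T g + ∑ ts (contribution j T g)
  potential-stage j []       T g = sym (trans (+-congˡ (reflexive ∑-[])) (+-identityʳ _))
  potential-stage j (t ∷ ts) T g = begin
    potential l (foldl applyLegal T′ (map (j ,_) ts)) g         ≈⟨ potential-stage j ts T′ g ⟩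
    potential l T′ g + ∑ ts (contribution j T′ g)
      ≈⟨ +-cong (potential-applyLegal j t T g) (∑-cong ts unaffected) ⟩
    (potential l T g + contribution j T g t) + ∑ ts (contribution j T g)
      ≈⟨ trans (+-assoc _ _ _) (+-congˡ (reflexive (≡.sym ∑-∷))) ⟩
    potential l T g + ∑ (t ∷ ts) (contribution j T g)           ∎
    where
    l  = suc (toℕ j)
    T′ = applyLegal T (j , t)

    unaffected : ∀ s → contribution j T′ g s ≈ contribution j T g s
    unaffected (x , σ , m) = reflexive (≡.cong
      (λ v → when (inF? r b (move m x)) (weight j σ m v * g (move m x) (just m)))
      (applyLegal-≢ T (j , t) ℕ.1+n≢n x σ))

  stage-≢ : ∀ j ts T {l} → suc (toℕ j) ≢ l → ∀ x σ →
            foldl applyLegal T (map (j ,_) ts) (l , x , σ) ≡ T (l , x , σ)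
  stage-≢ j []       T j≢l x σ = ≡.refl
  stage-≢ j (t ∷ ts) T j≢l x σ = ≡.trans
    (stage-≢ j ts (applyLegal T (j , t)) j≢l x σ) (applyLegal-≢ T (j , t) j≢l x σ)

  -- Adjointness: the contributions are indexed by their source, and the two moves out of `(x , σ)`
  -- assemble into the defining recursion of `pathSum`.
  ∑-contributions : ∀ {n} (v : Fin (suc n) → Carrier) j T → v zero ≡ u j →
    ∑ steps (contribution j T (pathSum (v ∘ suc))) ≈ potential (toℕ j) T (pathSum v)
  ∑-contributions v j T v≡u = trans (∑-cartesianProductWith _,_ (F r b) _)
    (∑-cong (F r b) λ x → trans (∑-cartesianProductWith _,_ previousMoves _)
      (∑-cong previousMoves λ σ → trans (∑-cong (L ∷ R ∷ []) (entry x σ))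
        (sym (*-∑ (T (toℕ j , x , σ)) (L ∷ R ∷ [])))))
    where
    entry : ∀ x σ m → contribution j T (pathSum (v ∘ suc)) (x , σ , m) ≈
      T (toℕ j , x , σ) * when (inF? r b (move m x))
        (pathSum (v ∘ suc) (move m x) (just m) * factor (v zero) σ m)
    entry x σ m = trans (when-cong (inF? r b (move m x)) λ _ →
        trans (*-congʳ (weight-factor j σ m _))
          (trans (*-assoc _ _ _) (*-congˡ (trans (*-comm _ _)
          (*-congˡ (reflexive (≡.cong (λ a → factor a σ m) (≡.sym v≡u))))))))
      (sym (*-when (inF? r b (move m x))))

  -- Induction on the number of stages left, `f` enumerating the corresponding tail of `Fin M`. The
  -- layers beyond `k` are assumed to be still zero, so that after the next stage its layer consists
  -- of the contributions alone.
  potential-foldl : ∀ n {k l} (f : Fin n → Fin (b 1 ∸ 1)) → (∀ i → toℕ (f i) ≡ k Nat.+ toℕ i) →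
    k Nat.+ n ≡ l →
    ∀ T → (∀ {k′} → k < k′ → ∀ x σ → T (k′ , x , σ) ≡ 0#) →
    potential l (foldl applyLegal T (cartesianProduct (tabulate f) steps))
      (λ x _ → when (x ≟ᶜ top) 1#) ≈
    potential k T (pathSum (u ∘ f))
  potential-foldl zero {k} f _ k+n≡l T _ =
    reflexive (≡.cong (λ l → potential l T (λ x _ → when (x ≟ᶜ top) 1#))
      (≡.trans (≡.sym k+n≡l) (ℕ.+-identityʳ k)))
  potential-foldl (suc n) {k} {l} f f≡k+ k+n≡l T T≡0 = begin
    potential l (foldl applyLegal T (map (f zero ,_) steps ++ rest))
      (λ x _ → when (x ≟ᶜ top) 1#)
      ≡⟨ ≡.cong (λ T → potential l T (λ x _ → when (x ≟ᶜ top) 1#))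
           (List.foldl-++ applyLegal T (map (f zero ,_) steps) rest) ⟩
    potential l (foldl applyLegal T′ rest) (λ x _ → when (x ≟ᶜ top) 1#)
      ≈⟨ potential-foldl n (f ∘ suc) (λ i → ≡.trans (f≡k+ (suc i)) (ℕ.+-suc k (toℕ i)))
           (≡.trans (≡.sym (ℕ.+-suc k n)) k+n≡l) T′
           (λ k<k′ x σ →
             ≡.trans (stage-≢ (f zero) steps T
             (λ eq → ℕ.<⇒≢ k<k′ (≡.trans (≡.cong suc (≡.sym f0≡k)) eq)) x σ)
                                 (T≡0 (ℕ.<-trans (ℕ.n<1+n k) k<k′) x σ)) ⟩
    potential (suc k) T′ (pathSum (u ∘ f ∘ suc))
      ≡⟨ ≡.cong (λ k → potential (suc k) T′ (pathSum (u ∘ f ∘ suc))) f0≡k ⟨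
    potential (suc (toℕ (f zero))) T′ (pathSum (u ∘ f ∘ suc))
      ≈⟨ potential-stage (f zero) steps T (pathSum (u ∘ f ∘ suc)) ⟩
    potential (suc (toℕ (f zero))) T (pathSum (u ∘ f ∘ suc)) + ∑ steps
      (contribution (f zero) T (pathSum (u ∘ f ∘ suc)))
      ≈⟨ +-cong (∑-0# (F r b) (λ x → ∑-0# previousMoves (λ σ →
           trans (*-congʳ (reflexive (T≡0 (ℕ.≤-reflexive (≡.cong suc (≡.sym f0≡k))) x σ)))
             (zeroˡ _))))
           (∑-contributions (u ∘ f) (f zero) T ≡.refl) ⟩
    0# + potential (toℕ (f zero)) T (pathSum (u ∘ f))
      ≈⟨ +-identityˡ _ ⟩
    potential (toℕ (f zero)) T (pathSum (u ∘ f))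
      ≡⟨ ≡.cong (λ k → potential k T (pathSum (u ∘ f))) f0≡k ⟩
    potential k T (pathSum (u ∘ f)) ∎
    where
    rest = cartesianProduct (tabulate (f ∘ suc)) steps
    T′   = foldl applyLegal T (map (f zero ,_) steps)

    f0≡k : toℕ (f zero) ≡ k
    f0≡k = ≡.trans (f≡k+ zero) (ℕ.+-identityʳ k)

  potential-initial : (∀ i → 1 ≤ i → i ≤ r → i ≤ b i) → (g : Cell → Previous → Carrier) →
    potential 0 initial g ≈ ∑ (upTo r) (λ i → g (suc i , suc i) nothing)
  potential-initial i≤bᵢ g = begin
    potential 0 initial g
      ≈⟨ ∑-cong (F r b) (λ x → trans ∑-previousMoves (trans
           (+-congˡ (trans (+-cong (zeroˡ (g x (just L))) (zeroˡ (g x (just R))))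
             (+-identityˡ 0#))) (+-identityʳ _))) ⟩
    ∑ (F r b) (λ (i , c) → initial (0 , (i , c) , nothing) * g (i , c) nothing)
      ≈⟨ ∑-F ⟩
    ∑ (upTo (suc r))
      (λ i → ∑ (upTo (suc (b i)))
      (λ c → when (inF? r b (i , c)) (initial (0 , (i , c) , nothing) * g (i , c) nothing)))
      ≈⟨ ∑-cong (upTo (suc r)) (λ i → ∑-cong (upTo (suc (b i))) (entry i)) ⟩
    ∑ (upTo (suc r)) (λ i → ∑ (upTo (suc (b i))) (λ c → when (c ℕ.≟ i) (h i c)))
      ≡⟨ ∑-upTo-suc r ⟩
    ∑ (upTo (suc (b 0))) (λ c → when (c ℕ.≟ 0) (h 0 c)) + ∑ (upTo r)
      (λ i → ∑ (upTo (suc (b (suc i)))) (λ c → when (c ℕ.≟ suc i) (h (suc i) c)))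
      -- Row 0 vanishes because `initial` demands `1 ≤ i`. In every other row `i ≤ b i` puts the
      -- diagonal cell inside the range of summation.
      ≈⟨ +-cong
           (∑-0# (upTo (suc (b 0)))
           (λ c → trans
           (when-cong (c ℕ.≟ 0)
           (λ _ → when-false (1 ℕ.≤? 0 ×-dec 0 ℕ.≤? r) λ ())) (when-0# (c ℕ.≟ 0))))
           (∑-upTo-cong r (λ i i<r → trans (∑-upTo-delta (s≤s (i≤bᵢ (suc i) (s≤s z≤n) i<r)))
             (when-true (1 ℕ.≤? suc i ×-dec suc i ℕ.≤? r) (s≤s z≤n , i<r)))) ⟩
    0# + ∑ (upTo r) (λ i → g (suc i , suc i) nothing)
      ≈⟨ +-identityˡ _ ⟩
    ∑ (upTo r) (λ i → g (suc i , suc i) nothing) ∎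
    where
    h : ℕ → ℕ → Carrier
    h i c = when (1 ℕ.≤? i ×-dec i ℕ.≤? r) (g (i , c) nothing)

    entry : ∀ i c →
      when (inF? r b (i , c)) (initial (0 , (i , c) , nothing) * g (i , c) nothing) ≈
      when (c ℕ.≟ i) (h i c)
    entry i c =
      trans (when-cong (inF? r b (i , c)) λ _ →
      trans (trans (*-congʳ (reflexive (if≡when diagonal?))) (when-* diagonal?))
      (when-cong diagonal? λ _ → *-identityˡ _))
      (trans (sym (when-× (inF? r b (i , c)) diagonal?))
      (trans (when-⇔ (inF? r b (i , c) ×-dec diagonal?)
        (c ℕ.≟ i ×-dec (1 ℕ.≤? i ×-dec i ℕ.≤? r))
        (λ { (_ , ≡.refl , 1≤i≤r) → ≡.refl , 1≤i≤r })
        (λ { (≡.refl , 1≤i , i≤r) →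
          ((1≤i , i≤r) , ℕ.≤-refl , i≤bᵢ i 1≤i i≤r) , ≡.refl , 1≤i , i≤r })
        (λ _ → refl))
      (when-× (c ℕ.≟ i) (1 ℕ.≤? i ×-dec i ℕ.≤? r))))
      where diagonal? = i ℕ.≟ c ×-dec (1 ℕ.≤? i ×-dec i ℕ.≤? r)

  result≈totalPathSum : 1 ≤ r → (∀ i → 1 ≤ i → i ≤ r → i ≤ b i) → result ≈ totalPathSum u
  result≈totalPathSum 1≤r i≤bᵢ = begin
    result
      ≡⟨ ∑-def ⟩
    ∑ previousMoves (λ σ → G (M , top , σ))
      -- The result becomes the pairing of layer `M` with the indicator of the top, which is
      -- `pathSum` when no letter is left.
      ≈⟨ ∑-F-delta ((s≤s z≤n , 1≤r) , i≤bᵢ 1 ℕ.≤-refl 1≤r , ℕ.≤-refl) ⟨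
    ∑ (F r b) (λ x → when (x ≟ᶜ top) (∑ previousMoves (λ σ → G (M , x , σ))))
      ≈⟨ ∑-cong (F r b)
           (λ x → trans (when-∑ (x ≟ᶜ top) previousMoves) (∑-cong previousMoves λ σ →
           trans (when-cong (x ≟ᶜ top) (λ _ → sym (*-identityʳ _)))
             (sym (*-when (x ≟ᶜ top))))) ⟩
    potential M G (λ x _ → when (x ≟ᶜ top) 1#)
      ≡⟨ ≡.cong (λ T → potential M T (λ x _ → when (x ≟ᶜ top) 1#))
           (foldl-legal initial (cartesianProduct (allFin M) steps)) ⟩
    potential M (foldl applyLegal initial (cartesianProduct (allFin M) steps))
      (λ x _ → when (x ≟ᶜ top) 1#)
      ≈⟨ potential-foldl M id (λ _ → ≡.refl) ≡.refl initial (λ { (s≤s _) _ _ → ≡.refl }) ⟩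
    potential 0 initial (pathSum u)
      ≈⟨ potential-initial i≤bᵢ (pathSum u) ⟩
    totalPathSum u ∎
    where M = b 1 ∸ 1

-- Transport of path sums between rings

module PathSumHomomorphism {c ℓ c′ ℓ′} {S : RawRing c ℓ} {S′ : RawRing c′ ℓ′}
    (E : CommutativeRingOn S) (E′ : CommutativeRingOn S′) (r : ℕ) (b : ℕ → ℕ) where
  private
    module E  = Sums E
    module E′ = Sums E′
    open E′ using (_≈_; ∑; when)
    module P  = PathSums E r b
    module P′ = PathSums E′ r b

  module _ (h : E.Carrier → E′.Carrier)
    (h-cong : ∀ {x y} → x E.≈ y → h x ≈ h y)
    (h-+  : ∀ x y → h (x E.+ y) ≈ h x E′.+ h y)
    (h-0# : h E.0# ≈ E′.0#)
    (h-1# : h E.1# ≈ E′.1#) where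

    h-∑ : ∀ {X : Set} (xs : List X) {f : X → E.Carrier} → h (E.∑ xs f) ≈ ∑ xs (h ∘ f)
    h-∑ []       = E′.trans (h-cong (E.reflexive E.∑-[]))
      (E′.trans h-0# (E′.reflexive (≡.sym E′.∑-[])))
    h-∑ (x ∷ xs) = E′.trans (h-cong (E.reflexive E.∑-∷)) (E′.trans (h-+ _ _)
      (E′.trans (E′.+-congˡ (h-∑ xs)) (E′.reflexive (≡.sym E′.∑-∷))))

    h-when : ∀ {P : Set} (P? : Dec P) {x} → h (E.when P? x) ≈ when P? (h x)
    h-when P?@(yes p) = E′.trans (h-cong (E.when-true P? p)) (E′.sym (E′.when-true P? p))
    h-when P?@(no ¬p) = E′.trans (h-cong (E.when-false P? ¬p))
      (E′.trans h-0# (E′.sym (E′.when-false P? ¬p)))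

    -- The only products in `pathSum` are with `1#` or with some `u j`, so compatibility of `h` with
    -- these replaces multiplicativity.
    pathSum-homo : ∀ {n} (u : Fin n → E.Carrier) (u′ : Fin n → E′.Carrier) →
      (∀ j x → h (x E.* u j) ≈ h x E′.* u′ j) → ∀ x σ → h (P.pathSum u x σ) ≈ P′.pathSum u′ x σ
    pathSum-homo {zero}  u u′ h-* x σ = E′.trans (h-when (x ≟ᶜ P.top))
      (E′.when-cong (x ≟ᶜ P.top) λ _ → h-1#)
    pathSum-homo {suc n} u u′ h-* x σ = E′.trans (h-∑ (L ∷ R ∷ []))
      (E′.∑-cong (L ∷ R ∷ []) λ m →
      E′.trans (h-when (inF? r b (move m x))) (E′.when-cong (inF? r b (move m x)) λ _ →
        E′.trans (h-factor σ m _)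
          (E′.*-congʳ (pathSum-homo (u ∘ suc) (u′ ∘ suc) (h-* ∘ suc) (move m x) (just m)))))
      where
      h-*1# : ∀ y → h (y E.* E.1#) ≈ h y E′.* E′.1#
      h-*1# y = E′.trans (h-cong (E.*-identityʳ y)) (E′.sym (E′.*-identityʳ (h y)))

      h-factor : ∀ σ m y → h (y E.* P.factor (u zero) σ m) ≈ h y E′.* P′.factor (u′ zero) σ m
      h-factor (just L) L = h-*1#
      h-factor (just R) L = h-* zero
      h-factor nothing  L = h-* zero
      h-factor (just L) R = h-*1#
      h-factor (just R) R = h-*1#
      h-factor nothing  R = h-*1#

    totalPathSum-homo : ∀ {n} (u : Fin n → E.Carrier) (u′ : Fin n → E′.Carrier) →
      (∀ j x → h (x E.* u j) ≈ h x E′.* u′ j) → h (P.totalPathSum u) ≈ P′.totalPathSum u′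
    totalPathSum-homo u u′ h-* = E′.trans (h-∑ (upTo r))
      (E′.∑-cong (upTo r) λ i → pathSum-homo u u′ h-* (suc i , suc i) nothing)

-- Words

-- The descent condition in a form that survives dropping the first letter: `σ` remembers the letter
-- before the word, which `IsDescent` looks up by position.
Turn : ∀ {n} → Previous → Vec Letter n → Fin n → Set
Turn σ (m ∷ w) zero    = m ≡ L × (σ ≡ nothing ⊎ σ ≡ just R)
Turn σ (m ∷ w) (suc j) = Turn (just m) w j

-- Seen from `m ∷ w`, the letter before position `suc j` stands at `pred (suc j)`, that is, at
-- `inject₁ j`.
lookup⇒turn : ∀ {n} m (w : Vec Letter n) j →
              lookup w j ≡ L → lookup (m ∷ w) (inject₁ j) ≡ R → Turn (just m) w j
lookup⇒turn m (x ∷ w) zero    x≡L m≡R = x≡L , inj₂ (≡.cong just m≡R)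
lookup⇒turn m (x ∷ w) (suc j) = lookup⇒turn x w j

turn⇒lookup : ∀ {n} m (w : Vec Letter n) j →
              Turn (just m) w j → lookup w j ≡ L × lookup (m ∷ w) (inject₁ j) ≡ R
turn⇒lookup m (x ∷ w) zero    (x≡L , inj₂ ≡.refl) = x≡L , ≡.refl
turn⇒lookup m (x ∷ w) (suc j) = turn⇒lookup x w j

descent⇒turn : ∀ {n} (w : Vec Letter n) j → IsDescent w j → Turn nothing w j
descent⇒turn (m ∷ w) zero    (m≡L , _)        = m≡L , inj₁ ≡.refl
descent⇒turn (m ∷ w) (suc j) (wⱼ≡L , inj₂ eq) = lookup⇒turn m w j wⱼ≡L eq

turn⇒descent : ∀ {n} (w : Vec Letter n) j → Turn nothing w j → IsDescent w j
turn⇒descent (m ∷ w) zero    (m≡L , _) = m≡L , inj₁ ≡.refl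
turn⇒descent (m ∷ w) (suc j) t with turn⇒lookup m w j t
... | wⱼ≡L , eq = wⱼ≡L , inj₂ eq

#L+#R≡length : (w : List Letter) → # L w Nat.+ # R w ≡ List.length w
#L+#R≡length []      = ≡.refl
#L+#R≡length (L ∷ w) = ≡.cong suc (#L+#R≡length w)
#L+#R≡length (R ∷ w) = ≡.trans (ℕ.+-suc (# L w) (# R w)) (≡.cong suc (#L+#R≡length w))

length-toList : ∀ {n} (w : Vec Letter n) → List.length (toList w) ≡ n
length-toList []      = ≡.refl
length-toList (x ∷ w) = ≡.cong suc (length-toList w)

module Words (r : ℕ) (b : ℕ → ℕ) where

  Path : ∀ {n} → Cell → Vec Letter n → Set
  Path x []      = x ≡ (1 , b 1)
  Path x (m ∷ w) = InF r b (move m x) × Path (move m x) w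

  path? : ∀ {n} x (w : Vec Letter n) → Dec (Path x w)
  path? x []      = x ≟ᶜ (1 , b 1)
  path? x (m ∷ w) = inF? r b (move m x) ×-dec path? (move m x) w

  -- The prefix condition of admissibility is the case `x = (ι w , ι w)`. An arbitrary starting cell
  -- is needed for the induction along the word.
  PrefixBound : Cell → List Letter → Set
  PrefixBound (i , c) p = c Nat.+ # R p ≤ b (i ∸ # L p)

  prefixBound-L : ∀ {i c} p → PrefixBound (i ∸ 1 , c) p ≡ PrefixBound (i , c) (L ∷ p)
  prefixBound-L {i} {c} p = ≡.cong (λ k → c Nat.+ # R p ≤ b k) (ℕ.∸-+-assoc i 1 (# L p))

  prefixBound-R : ∀ {i c} p → PrefixBound (i , suc c) p ≡ PrefixBound (i , c) (R ∷ p)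
  prefixBound-R {i} {c} p = ≡.cong (λ k → k ≤ b (i ∸ # L p)) (≡.sym (ℕ.+-suc c (# R p)))

  prefixBound-move : ∀ x m p → PrefixBound (move m x) p ≡ PrefixBound x (m ∷ p)
  prefixBound-move (i , c) L p = prefixBound-L {i} {c} p
  prefixBound-move (i , c) R p = prefixBound-R {i} {c} p

  prefixBound-[] : ∀ {x} → InF r b x → PrefixBound x []
  prefixBound-[] {i , c} (_ , _ , c≤b) = ≡.subst (_≤ b i) (≡.sym (ℕ.+-identityʳ c)) c≤b

  -- After a prefix `p` the path stands at `(i ∸ # L p , c + # R p)`. So the bounds express the
  -- condition `c ≤ b i` at each visited cell, and the two equations say that the path ends at the
  -- top.
  path⇒ : ∀ {n} x (w : Vec Letter n) → InF r b x → Path x w →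
    proj₁ x ≡ suc (# L (toList w)) × proj₂ x Nat.+ # R (toList w) ≡ b 1 × All (PrefixBound x)
      (inits (toList w))
  path⇒ x       []      x∈F ≡.refl = ≡.refl , ℕ.+-identityʳ (b 1) , prefixBound-[] x∈F ∷ []
  path⇒ x       (m ∷ w) x∈F (y∈F , path) with path⇒ (move m x) w y∈F path
  ... | i≡ , c≡ , bounds = start m x x∈F i≡ , end m x c≡ ,
        prefixBound-[] x∈F ∷ All.map⁺
          (All.map (λ {p} → ≡.subst id (prefixBound-move x m p)) bounds)
    where
    start : ∀ m x → InF r b x → proj₁ (move m x) ≡ suc (# L (toList w)) →
      proj₁ x ≡ suc (# L (toList (m ∷ w)))
    start L (suc i , c) _ eq = ≡.cong suc eq
    start R (i , c)     _ eq = eq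

    end : ∀ m x → proj₂ (move m x) Nat.+ # R (toList w) ≡ b 1 →
      proj₂ x Nat.+ # R (toList (m ∷ w)) ≡ b 1
    end L (i , c) eq = eq
    end R (i , c) eq = ≡.trans (ℕ.+-suc c (# R (toList w))) eq

  -- The remaining conditions of `F` are automatic: rows never increase, columns never decrease, and
  -- the row cannot fall below 1 because exactly `i - 1` letters `L` are available.
  path⇐ : ∀ {n} x (w : Vec Letter n) → InF r b x →
    proj₁ x ≡ suc (# L (toList w)) → proj₂ x Nat.+ # R (toList w) ≡ b 1 →
      All (PrefixBound x) (inits (toList w)) → Path x w
  path⇐ (i , c) [] x∈F ≡.refl c≡ _ = ≡.cong (1 ,_) (≡.trans (≡.sym (ℕ.+-identityʳ c)) c≡)
  path⇐ x (m ∷ w) x∈F i≡ c≡ (_ ∷ bounds) = y∈F m x x∈F i≡ (All.head bounds′) , path⇐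
    (move m x) w (y∈F m x x∈F i≡ (All.head bounds′)) (start m x i≡) (end m x c≡) bounds′
    where
    bounds′ : All (PrefixBound (move m x)) (inits (toList w))
    bounds′ = All.map (λ {p} → ≡.subst id (≡.sym (prefixBound-move x m p))) (All.map⁻ bounds)

    y∈F : ∀ m x → InF r b x → proj₁ x ≡ suc (# L (toList (m ∷ w))) → PrefixBound (move m x) [] →
      InF r b (move m x)
    y∈F L (suc i , c) ((_ , i≤r) , i≤c , _) ≡.refl bound =
      (s≤s z≤n , ℕ.≤-trans (ℕ.n≤1+n i) i≤r) , ℕ.≤-trans (ℕ.n≤1+n i) i≤c , ≡.subst (_≤ b i)
        (ℕ.+-identityʳ c) bound
    y∈F R (i , c)     (1≤i≤r , i≤c , _) _ bound = 1≤i≤r , ℕ.m≤n⇒m≤1+n i≤c , ≡.subst (_≤ b i)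
      (ℕ.+-identityʳ (suc c)) bound

    start : ∀ m x → proj₁ x ≡ suc (# L (toList (m ∷ w))) → proj₁ (move m x) ≡
      suc (# L (toList w))
    start L (i , c) eq = ≡.cong (_∸ 1) eq
    start R (i , c) eq = eq

    end : ∀ m x → proj₂ x Nat.+ # R (toList (m ∷ w)) ≡ b 1 →
      proj₂ (move m x) Nat.+ # R (toList w) ≡ b 1
    end L (i , c) eq = eq
    end R (i , c) eq = ≡.trans (≡.sym (ℕ.+-suc c (# R (toList w)))) eq

  module _ (1≤r : 1 ≤ r) (i≤bᵢ : ∀ i → 1 ≤ i → i ≤ r → i ≤ b i) where

    diagonal∈F : ∀ {i} → i < r → InF r b (suc i , suc i)
    diagonal∈F {i} i<r = (s≤s z≤n , i<r) , ℕ.≤-refl , i≤bᵢ (suc i) (s≤s z≤n) i<r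

    path⇒admissible : ∀ {i} → i < r → (w : Vec Letter (b 1 ∸ 1)) → Path (suc i , suc i) w →
                      i ≡ # L (toList w) × Admissible r b w
    path⇒admissible {i} i<r w path with path⇒ _ w (diagonal∈F i<r) path
    ... | ≡.refl , _ , bounds = ≡.refl , ℕ.<⇒≤pred i<r ,
      ≡.subst (λ k → All (PrefixBound (k , k)) (inits (toList w))) (ℕ.+-comm 1 (# L (toList w)))
        bounds

    admissible⇒path : ∀ {i} → i < r → (w : Vec Letter (b 1 ∸ 1)) →
                      i ≡ # L (toList w) → Admissible r b w → Path (suc i , suc i) w
    admissible⇒path i<r w ≡.refl (_ , bounds) = path⇐ _ w (diagonal∈F i<r) ≡.refl
      -- The final column is 1 plus the number of all letters, hence `1 + M`, and this is `b 1`
      -- because `1 ≤ b 1`.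
      (≡.trans (≡.cong suc (≡.trans (#L+#R≡length (toList w)) (length-toList w)))
        (ℕ.m+[n∸m]≡n (i≤bᵢ 1 ℕ.≤-refl 1≤r)))
      (≡.subst (λ k → All (PrefixBound (k , k)) (inits (toList w)))
        (ℕ.+-comm (# L (toList w)) 1) bounds)

  module _ {c ℓ} {S : RawRing c ℓ} (E : CommutativeRingOn S) where
    open Sums E
    open PathSums E r b

    wordWeight : ∀ {n} → (Fin n → Carrier) → Previous → Vec Letter n → Carrier
    wordWeight u σ []      = 1#
    wordWeight u σ (m ∷ w) = wordWeight (u ∘ suc) (just m) w * factor (u zero) σ m

    pathSum-words : ∀ {n} (u : Fin n → Carrier) x σ →
      pathSum u x σ ≈ ∑ (tuples (L ∷ R ∷ []) n) (λ w → when (path? x w) (wordWeight u σ w))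
    pathSum-words {zero}  u x σ =
      sym (trans (reflexive ∑-∷) (trans (+-congˡ (reflexive ∑-[])) (+-identityʳ _)))
    pathSum-words {suc n} u x σ =
      sym (trans (∑-cartesianProductWith _∷_ (L ∷ R ∷ []) (tuples (L ∷ R ∷ []) n))
      (∑-cong (L ∷ R ∷ []) λ m → begin
        ∑ (tuples (L ∷ R ∷ []) n) (λ w → when (path? x (m ∷ w)) (wordWeight u σ (m ∷ w)))
          ≈⟨ ∑-cong (tuples (L ∷ R ∷ []) n)
               (λ w → when-× (inF? r b (move m x)) (path? (move m x) w)) ⟩
        ∑ (tuples (L ∷ R ∷ []) n)
          (λ w → when (inF? r b (move m x))
          (when (path? (move m x) w) (wordWeight u σ (m ∷ w))))
          ≈⟨ when-∑ (inF? r b (move m x)) (tuples (L ∷ R ∷ []) n) ⟨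
        when (inF? r b (move m x))
          (∑ (tuples (L ∷ R ∷ []) n) (λ w → when (path? (move m x) w) (wordWeight u σ (m ∷ w))))
          ≈⟨ when-cong (inF? r b (move m x))
               (λ _ → trans
               (∑-cong (tuples (L ∷ R ∷ []) n) (λ w → sym (when-* (path? (move m x) w))))
               (trans (sym (∑-* (tuples (L ∷ R ∷ []) n) (factor (u zero) σ m)))
                 (*-congʳ (sym (pathSum-words (u ∘ suc) (move m x) (just m)))))) ⟩
        when (inF? r b (move m x)) (pathSum (u ∘ suc) (move m x) (just m) * factor (u zero) σ m)
          ∎))

    -- `f` places the remaining word inside the full one: the predicate and the weights stay those
    -- of the full word while the induction consumes letters.
    ∏-turns : ∀ {n N} {P : U.Pred (Fin N) 0ℓ} (P? : U.Decidable P) (u : Fin N → Carrier)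
      (f : Fin n → Fin N) σ (w : Vec Letter n) →
      (∀ j → P (f j) → Turn σ w j) → (∀ j → Turn σ w j → P (f j)) →
      ∏ (filter P? (tabulate f)) u ≈ wordWeight (u ∘ f) σ w
    ∏-turns P? u f σ []      P⇒T T⇒P = refl
    ∏-turns P? u f σ (m ∷ w) P⇒T T⇒P with P? (f zero)
    ... | yes p =
      trans (*-comm _ _) (*-cong (∏-turns P? u (f ∘ suc) (just m) w (P⇒T ∘ suc) (T⇒P ∘ suc))
                    (reflexive (≡.sym (turn-factor σ m (P⇒T zero p)))))
      where
      turn-factor : ∀ σ m → Turn σ (m ∷ w) zero → factor (u (f zero)) σ m ≡ u (f zero)
      turn-factor nothing  L _ = ≡.refl
      turn-factor (just R) L _ = ≡.refl
      turn-factor (just L) L (_ , inj₂ ())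
    ... | no ¬p = trans (∏-turns P? u (f ∘ suc) (just m) w (P⇒T ∘ suc) (T⇒P ∘ suc))
                    (trans (sym (*-identityʳ _))
                      (*-congˡ (reflexive (≡.sym (straight-factor σ m (¬p ∘ T⇒P zero))))))
      where
      straight-factor : ∀ σ m → ¬ Turn σ (m ∷ w) zero → factor (u (f zero)) σ m ≡ 1#
      straight-factor nothing  L ¬t = contradiction (≡.refl , inj₁ ≡.refl) ¬t
      straight-factor (just R) L ¬t = contradiction (≡.refl , inj₂ ≡.refl) ¬t
      straight-factor (just L) L _  = ≡.refl
      straight-factor nothing  R _  = ≡.refl
      straight-factor (just L) R _  = ≡.refl
      straight-factor (just R) R _  = ≡.refl

    ∑-words : 1 ≤ r → (∀ i → 1 ≤ i → i ≤ r → i ≤ b i) → (u : Fin (b 1 ∸ 1) → Carrier) →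
      ∑ (words r b) (λ w → ∏ (descents w) u) ≈ totalPathSum u
    ∑-words 1≤r i≤bᵢ u = begin
      ∑ (words r b) (λ w → ∏ (descents w) u)
        ≈⟨ trans (∑-filter (admissible? r b) ws)
             (∑-cong ws λ w → when-cong (admissible? r b w) λ _ →
             ∏-turns (isDescent? w) u id nothing w (descent⇒turn w) (turn⇒descent w)) ⟩
      ∑ ws (λ w → when (admissible? r b w) (wordWeight u nothing w))
        -- An admissible word is a path from exactly one diagonal cell, the one in row `# L + 1`.
        -- The delta records this row; afterwards the two sums can be exchanged.
        ≈⟨ ∑-cong ws (λ w → trans
             (when-cong (admissible? r b w)
               (λ { (#L≤ , _) →
               sym (∑-upTo-delta (ℕ.≤-<-trans #L≤ (ℕ.≤-reflexive (ℕ.m+[n∸m]≡n 1≤r)))) }))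
             (when-∑ (admissible? r b w) (upTo r))) ⟩
      ∑ ws (λ w →
        ∑ (upTo r)
        (λ i → when (admissible? r b w) (when (i ℕ.≟ # L (toList w)) (wordWeight u nothing w))))
        ≈⟨ ∑-swap ws (upTo r) ⟩
      ∑ (upTo r)
        (λ i → ∑ ws
        (λ w → when (admissible? r b w) (when (i ℕ.≟ # L (toList w)) (wordWeight u nothing w))))
        ≈⟨ ∑-upTo-cong r
             (λ i i<r → ∑-cong ws λ w →
             trans (sym (when-× (admissible? r b w) (i ℕ.≟ # L (toList w))))
             (when-⇔ (admissible? r b w ×-dec i ℕ.≟ # L (toList w)) (path? (suc i , suc i) w)
               (λ { (adm , i≡) → admissible⇒path 1≤r i≤bᵢ i<r w i≡ adm })
               (λ path → let (i≡ , adm) = path⇒admissible 1≤r i≤bᵢ i<r w path in adm , i≡)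
               (λ _ → refl))) ⟩
      ∑ (upTo r) (λ i → ∑ ws (λ w → when (path? (suc i , suc i) w) (wordWeight u nothing w)))
        ≈⟨ ∑-cong (upTo r) (λ i → pathSum-words u (suc i , suc i) nothing) ⟨
      totalPathSum u ∎
      where ws = tuples (L ∷ R ∷ []) (b 1 ∸ 1)

-- Generating functions of multichains

record FerrersShape (r : ℕ) (b : ℕ → ℕ) : Set where
  field
    1≤r   : 1 ≤ r
    b-dec : ∀ i → 1 ≤ i → i < r → b (suc i) ≤ b i
    i≤bᵢ  : ∀ i → 1 ≤ i → i ≤ r → i ≤ b i

  1≤b₁ : 1 ≤ b 1
  1≤b₁ = i≤bᵢ 1 ℕ.≤-refl 1≤r

  b≤b₁ : ∀ {i} → 1 ≤ i → i ≤ r → b i ≤ b 1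
  b≤b₁ {suc zero}    _ _   = ℕ.≤-refl
  b≤b₁ {suc (suc i)} _ i≤r = ℕ.≤-trans (b-dec (suc i) (s≤s z≤n) i≤r)
    (b≤b₁ (s≤s z≤n) (ℕ.<⇒≤ i≤r))

  top∈F : InF r b (1 , b 1)
  top∈F = (ℕ.≤-refl , 1≤r) , 1≤b₁ , ℕ.≤-refl

  ρ≤M : ∀ {x} → InF r b x → ρ x ≤ b 1 ∸ 1
  ρ≤M {i , c} ((1≤i , i≤r) , _ , c≤b) = ℕ.∸-mono (ℕ.≤-trans c≤b (b≤b₁ 1≤i i≤r)) 1≤i

  -- From `c = M + i` and `c ≤ b 1 = M + 1` it follows that `i ≤ 1`.
  ρ≡M⇒top : ∀ {x} → InF r b x → ρ x ≡ b 1 ∸ 1 → x ≡ (1 , b 1)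
  ρ≡M⇒top {i , c} ((1≤i , i≤r) , i≤c , c≤b) eq =
    ≡.cong₂ _,_ i≡1 (≡.trans c≡ (≡.trans (≡.cong (b 1 ∸ 1 Nat.+_) i≡1) (ℕ.m∸n+n≡m 1≤b₁)))
    where
    c≡ : c ≡ b 1 ∸ 1 Nat.+ i
    c≡ = ≡.trans (≡.sym (ℕ.m∸n+n≡m i≤c)) (≡.cong (Nat._+ i) eq)

    i≡1 : i ≡ 1
    i≡1 = ℕ.≤-antisym
      (ℕ.+-cancelˡ-≤ (b 1 ∸ 1) i 1
      (≡.subst₂ _≤_ c≡ (≡.sym (ℕ.m∸n+n≡m 1≤b₁)) (ℕ.≤-trans c≤b (b≤b₁ 1≤i i≤r)))) 1≤i

module ZetaNumerator {c ℓ} {S : RawRing c ℓ} (E : CommutativeRingOn S)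
    {r : ℕ} {b : ℕ → ℕ} (shape : FerrersShape r b)
    (z : ℕ → RawRing.Carrier S) (V : Cell → RawRing.Carrier S) where
  open Sums E
  open PathSums E r b
  open FerrersShape shape
  open GroupProperties +-group using (∙-cancelʳ)
  open Solver commutativeSemiring using (solve; _:=_; _:+_; _:*_; con)

  when-⊎ : ∀ {P Q Q′ : Set} (P? : Dec P) (Q? : Dec Q) (Q′? : Dec Q′) {x} →
           (P → Q ⊎ Q′) → (Q → P × ¬ Q′) → (Q′ → P) → when P? x ≈ when Q? x + when Q′? x
  when-⊎ P? (yes q) Q′? f g h = trans (when-true P? (proj₁ (g q))) (sym (trans
    (+-cong (when-true (yes q) q) (when-false Q′? (proj₂ (g q)))) (+-identityʳ _)))
  when-⊎ P? (no ¬q) Q′? f g h = trans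
    (when-⇔ P? Q′? (λ p → case (f p)) h (λ _ → refl))
    (sym (trans (+-congʳ (when-false (no ¬q) ¬q)) (+-identityˡ _)))
    where
    case : _ ⊎ _ → _
    case (inj₁ q)  = contradiction q ¬q
    case (inj₂ q′) = q′

  ∑-F-rows : {f : Cell → Carrier} → ∑ (F r b) f ≈
    ∑ (upTo r) (λ i → ∑ (upTo (suc (b (suc i)))) (λ d → when (suc i ℕ.≤? d) (f (suc i , d))))
  ∑-F-rows {f} = begin
    ∑ (F r b) f  ≈⟨ ∑-F ⟩
    ∑ (upTo (suc r)) row  ≡⟨ ∑-upTo-suc r ⟩
    row 0 + ∑ (upTo r) (row ∘ suc)
      ≈⟨ trans (+-congʳ (∑-0# (upTo (suc (b 0))) λ d →
           when-false (inF? r b (0 , d)) λ { ((() , _) , _) })) (+-identityˡ _) ⟩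
    ∑ (upTo r) (row ∘ suc)
      ≈⟨ ∑-upTo-cong r (λ i i<r → ∑-upTo-cong (suc (b (suc i))) λ { d (s≤s d≤b) →
           when-⇔ (inF? r b (suc i , d)) (suc i ℕ.≤? d) (proj₁ ∘ proj₂)
             (λ i≤d → (s≤s z≤n , i<r) , i≤d , d≤b) (λ _ → refl) }) ⟩
    _ ∎
    where
    row : ℕ → Carrier
    row i = ∑ (upTo (suc (b i))) (λ d → when (inF? r b (i , d)) (f (i , d)))

  -- The multichains with least element `x`: the factor `z (ρ x)` stands for `x` itself and `V x`
  -- for the rest.
  W : Cell → Carrier
  W x = z (ρ x) * V x

  row : ℕ → ℕ → Carrier
  row i c = ∑ (upTo (suc (b i))) (λ d → when (c ℕ.≤? d) (W (i , d)))

  T : ℕ → ℕ → Carrier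
  T i c = when (i ℕ.≟ 1) 1# + row i c

  row-step : ∀ i c → c ≤ b i → row i c ≈ W (i , c) + row i (suc c)
  row-step i c c≤b = begin
    row i c
      ≈⟨ ∑-cong (upTo (suc (b i))) (λ d → when-⊎ (c ℕ.≤? d) (d ℕ.≟ c) (suc c ℕ.≤? d) (split d)
           (λ { ≡.refl → ℕ.≤-refl , ℕ.<-irrefl ≡.refl }) ℕ.<⇒≤) ⟩
    ∑ (upTo (suc (b i))) (λ d → when (d ℕ.≟ c) (W (i , d)) + when (suc c ℕ.≤? d) (W (i , d)))
      ≈⟨ ∑-+ (upTo (suc (b i))) ⟩
    ∑ (upTo (suc (b i))) (λ d → when (d ℕ.≟ c) (W (i , d))) + row i (suc c)
      ≈⟨ +-congʳ (∑-upTo-delta (s≤s c≤b)) ⟩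
    W (i , c) + row i (suc c) ∎
    where
    split : ∀ d → c ≤ d → d ≡ c ⊎ c < d
    split d c≤d with ℕ.m≤n⇒m<n∨m≡n c≤d
    ... | inj₁ c<d = inj₂ c<d
    ... | inj₂ c≡d = inj₁ (≡.sym c≡d)

  row-empty : ∀ i c → b i < c → row i c ≈ 0#
  row-empty i c b<c = trans
    (∑-upTo-cong (suc (b i))
      (λ { d (s≤s d≤b) → when-false (c ℕ.≤? d) (ℕ.<⇒≱ (ℕ.≤-<-trans d≤b b<c)) }))
    (∑-0# (upTo (suc (b i))) λ _ → refl)

  T-step : ∀ i c → c ≤ b i → T i c ≈ W (i , c) + T i (suc c)
  T-step i c c≤b = trans (+-congˡ (row-step i c c≤b))
    (solve 3 (λ x y z → x :+ (y :+ z) := y :+ (x :+ z)) refl _ _ _)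

  -- Past the end of a row an `R` is illegal and must contribute 0, so only one row may own the
  -- empty multichain. It is row 1, where the leftover value 1 supplies the base case at the top.
  T-empty : ∀ i c → b i < c → i ≢ 1 → T i c ≈ 0#
  T-empty i c b<c i≢1 = trans (+-cong (when-false (i ℕ.≟ 1) i≢1) (row-empty i c b<c))
    (+-identityˡ 0#)

  ∑-when-1# : ∀ {i} → ∑ (upTo r) (λ j → when (j ℕ.≤? i) (when (suc j ℕ.≟ 1) 1#)) ≈ 1#
  ∑-when-1# {i} = trans (∑-cong (upTo r) (λ j → trans (sym (when-× (j ℕ.≤? i) (suc j ℕ.≟ 1)))
    (when-⇔ (j ℕ.≤? i ×-dec suc j ℕ.≟ 1) (j ℕ.≟ 0) (λ { (_ , ≡.refl) → ≡.refl })
      (λ { ≡.refl → z≤n , ≡.refl }) (λ _ → refl))))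
    (∑-upTo-delta 1≤r)

  1-z : ℕ → Carrier
  1-z a = 1# + - z a

  1-z+z : ∀ a → 1-z a + z a ≈ 1#
  1-z+z a = trans (+-assoc 1# (- z a) (z a))
    (trans (+-congˡ (-‿inverseˡ (z a))) (+-identityʳ 1#))

  module _ (V-rec : ∀ {x} → InF r b x → V x ≈ 1# + ∑ (F r b) (λ y → when (x ≼? y) (W y))) where

    -- The multichains above `x` are sorted by the row of their least element, with the empty one in
    -- row 1. All rows share the cutoff `c`: from `j ≤ i` and `suc i ≤ c ≤ d` the condition
    -- `suc j ≤ d` of `F` follows by itself.
    V-columns : ∀ {i c} → InF r b (suc i , c) → V (suc i , c) ≈
      ∑ (upTo r) (λ j → when (j ℕ.≤? i) (T (suc j) c))
    V-columns {i} {c} x∈F@(_ , i≤c , _) = begin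
      V (suc i , c)
        ≈⟨ V-rec x∈F ⟩
      1# + ∑ (F r b) (λ y → when ((suc i , c) ≼? y) (W y))
        ≈⟨ +-cong (sym ∑-when-1#) (trans ∑-F-rows (∑-cong (upTo r) λ j →
             trans (∑-cong (upTo (suc (b (suc j)))) (entry j))
               (sym (when-∑ (j ℕ.≤? i) (upTo (suc (b (suc j)))))))) ⟩
      ∑ (upTo r) (λ j → when (j ℕ.≤? i) (when (suc j ℕ.≟ 1) 1#)) + ∑ (upTo r)
        (λ j → when (j ℕ.≤? i) (row (suc j) c))
        ≈⟨ ∑-+ (upTo r) ⟨
      ∑ (upTo r) (λ j → when (j ℕ.≤? i) (when (suc j ℕ.≟ 1) 1#) + when (j ℕ.≤? i)
        (row (suc j) c))
        ≈⟨ ∑-cong (upTo r) (λ j → when-+ (j ℕ.≤? i)) ⟩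
      ∑ (upTo r) (λ j → when (j ℕ.≤? i) (T (suc j) c)) ∎
      where
      when-+ : ∀ {P : Set} (P? : Dec P) {x y} → when P? x + when P? y ≈ when P? (x + y)
      when-+ P?@(yes p) = trans (+-cong (when-true P? p) (when-true P? p))
        (sym (when-true P? p))
      when-+ P?@(no ¬p) = trans (+-cong (when-false P? ¬p) (when-false P? ¬p))
        (trans (+-identityˡ 0#) (sym (when-false P? ¬p)))

      entry : ∀ j d → when (suc j ℕ.≤? d) (when ((suc i , c) ≼? (suc j , d)) (W (suc j , d))) ≈
                      when (j ℕ.≤? i) (when (c ℕ.≤? d) (W (suc j , d)))
      entry j d = trans (sym (when-× (suc j ℕ.≤? d) ((suc i , c) ≼? (suc j , d))))
        (trans (when-⇔ (suc j ℕ.≤? d ×-dec (suc i , c) ≼? (suc j , d)) (j ℕ.≤? i ×-dec c ℕ.≤? d)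
          (λ { (_ , s≤s j≤i , c≤d) → j≤i , c≤d })
          (λ { (j≤i , c≤d) → ℕ.≤-trans (s≤s j≤i) (ℕ.≤-trans i≤c c≤d) , s≤s j≤i , c≤d })
          (λ _ → refl))
        (when-× (j ℕ.≤? i) (c ℕ.≤? d)))

    V↓ : Cell → Carrier
    V↓ x = when (inF? r b (move L x)) (V (move L x))

    V-step : ∀ i c → InF r b (i , c) → V (i , c) ≈ V↓ (i , c) + T i c
    V-step (suc zero) c x∈F = begin
      V (1 , c)                                        ≈⟨ V-columns x∈F ⟩
      ∑ (upTo r) (λ j → when (j ℕ.≤? 0) (T (suc j) c))
        ≈⟨ ∑-cong (upTo r) (λ j → when-⇔ (j ℕ.≤? 0) (j ℕ.≟ 0) ℕ.n≤0⇒n≡0 ℕ.≤-reflexive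
        (λ _ → refl)) ⟩
      ∑ (upTo r) (λ j → when (j ℕ.≟ 0) (T (suc j) c))  ≈⟨ ∑-upTo-delta 1≤r ⟩
      T 1 c
        ≈⟨ trans (+-congʳ
        (when-false (inF? r b (0 , c)) λ { ((() , _) , _) })) (+-identityˡ _) ⟨
      V↓ (1 , c) + T 1 c                               ∎
    V-step (suc (suc i)) c x∈F@((_ , i<r) , i<c , c≤b) = begin
      V (suc (suc i) , c)
        ≈⟨ V-columns x∈F ⟩
      ∑ (upTo r) (λ j → when (j ℕ.≤? suc i) (T (suc j) c))
        ≈⟨ ∑-cong (upTo r) (λ j → when-⊎ (j ℕ.≤? suc i) (j ℕ.≟ suc i) (j ℕ.≤? i) split
             (λ { ≡.refl → ℕ.≤-refl , ℕ.<-irrefl ≡.refl }) ℕ.m≤n⇒m≤1+n) ⟩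
      ∑ (upTo r) (λ j → when (j ℕ.≟ suc i) (T (suc j) c) + when (j ℕ.≤? i) (T (suc j) c))
        ≈⟨ ∑-+ (upTo r) ⟩
      ∑ (upTo r) (λ j → when (j ℕ.≟ suc i) (T (suc j) c)) + ∑ (upTo r)
        (λ j → when (j ℕ.≤? i) (T (suc j) c))
        ≈⟨ +-cong (∑-upTo-delta i<r) (sym (V-columns y∈F)) ⟩
      T (suc (suc i)) c + V (suc i , c)
        ≈⟨ +-comm _ _ ⟩
      V (suc i , c) + T (suc (suc i)) c
        ≈⟨ +-congʳ (when-true (inF? r b (suc i , c)) y∈F) ⟨
      V↓ (suc (suc i) , c) + T (suc (suc i)) c ∎
      where
      y∈F : InF r b (suc i , c)
      -- This uses that the rows get weakly shorter: the cell in the preceding row and the same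
      -- column is again in `F`.
      y∈F = (s≤s z≤n , ℕ.<⇒≤ i<r) , ℕ.<⇒≤ i<c , ℕ.≤-trans c≤b (b-dec (suc i) (s≤s z≤n) i<r)

      split : ∀ {j} → j ≤ suc i → j ≡ suc i ⊎ j ≤ i
      split j≤1+i with ℕ.m≤n⇒m<n∨m≡n j≤1+i
      ... | inj₁ (s≤s j≤i) = inj₂ j≤i
      ... | inj₂ eq        = inj₁ eq

    -- `W x` occurs in `T i c`, hence in the expansion of `V x`. Adding it to both sides, rather
    -- than subtracting, keeps the calculation within semiring identities.
    1-z-* : ∀ {x} → InF r b x → 1-z (ρ x) * V x ≈ V↓ x + T (proj₁ x) (suc (proj₂ x))
    1-z-* {x@(i , c)} x∈F@(_ , _ , c≤b) = ∙-cancelʳ (W x) _ _ (begin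
      1-z k * V x + z k * V x             ≈⟨ distribʳ (V x) (1-z k) (z k) ⟨
      (1-z k + z k) * V x                 ≈⟨ trans (*-congʳ (1-z+z k)) (*-identityˡ (V x)) ⟩
      V x                                 ≈⟨ V-step i c x∈F ⟩
      V↓ x + T i c                        ≈⟨ +-congˡ (T-step i c c≤b) ⟩
      V↓ x + (W x + T i (suc c))
        ≈⟨ solve 3 (λ x y z → x :+ (y :+ z) := (x :+ z) :+ y) refl _ _ _ ⟩
      (V↓ x + T i (suc c)) + W x          ∎)
      where k = ρ x

    -- After `1 - z` is multiplied into `T-step`, the previous lemma replaces `(1 - z) V x`, and the
    -- coefficients `z` and `1 - z` of `T i (suc c)` add up to 1.
    1-z-*-T : ∀ {x} → InF r b x →
      1-z (ρ x) * T (proj₁ x) (proj₂ x) ≈ V↓ x * z (ρ x) + T (proj₁ x) (suc (proj₂ x))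
    1-z-*-T {x@(i , c)} x∈F@(_ , _ , c≤b) = begin
      y * T i c                             ≈⟨ *-congˡ (T-step i c c≤b) ⟩
      y * (z k * V x + T₊)
        ≈⟨ solve 4 (λ y z V T → y :* (z :* V :+ T) := (y :* V) :* z :+ y :* T) refl _ _ _ _ ⟩
      (y * V x) * z k + y * T₊              ≈⟨ +-congʳ (*-congʳ (1-z-* x∈F)) ⟩
      (V↓ x + T₊) * z k + y * T₊
        ≈⟨ solve 4 (λ y z V T → (V :+ T) :* z :+ y :* T := V :* z :+ (y :+ z) :* T) refl _ _ _
        _ ⟩
      V↓ x * z k + (y + z k) * T₊
        ≈⟨ +-congˡ (trans (*-congʳ (1-z+z k)) (*-identityˡ T₊)) ⟩
      V↓ x * z k + T₊                       ∎
      where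
      k = ρ x
      y = 1-z k
      T₊ = T i (suc c)

    pathSum-nothing : ∀ {n} (u : Fin n → Carrier) x → pathSum u x nothing ≈ pathSum u x (just R)
    pathSum-nothing {zero}  u x = refl
    pathSum-nothing {suc n} u x = ∑-cong (L ∷ R ∷ []) λ { L → refl ; R → refl }

    ρ-move : ∀ m {x} → InF r b x → InF r b (move m x) → ρ (move m x) ≡ suc (ρ x)
    ρ-move L {suc i , suc c} (_ , s≤s i≤c , _) _ = ℕ.+-∸-assoc 1 i≤c
    ρ-move R {i , c}         (_ , i≤c , _)     _ = ℕ.+-∸-assoc 1 i≤c

    -- `f` lists the ranks `k , … , M`, one more than there are letters left. It is a function known
    -- only pointwise, so that its shift `f ∘ suc` can serve in the induction.
    pathSum-closed : ∀ n k (u : Fin n → Carrier) (f : ℕ → ℕ) →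
      (∀ j → u j ≈ z (k Nat.+ toℕ j)) → (∀ a → f a ≡ k Nat.+ a) →
      ∀ {x} → InF r b x → ρ x ≡ k → k Nat.+ n ≡ b 1 ∸ 1 →
      pathSum u x (just L) ≈ ∏ (applyUpTo f (suc n)) 1-z * V x ×
      pathSum u x (just R) ≈ ∏ (applyUpTo f (suc n)) 1-z * T (proj₁ x) (proj₂ x)
    pathSum-closed zero k u f u≈ f≡ {x} x∈F ρ≡k k+n≡M
      with ρ≡M⇒top x∈F (≡.trans ρ≡k (≡.trans (≡.sym (ℕ.+-identityʳ k)) k+n≡M))
    -- At the top `V↓` is 0 and `T 1 (suc (b 1))` is 1, so `1 - z_M` times either series equals 1,
    -- the value of the empty path.
    ... | ≡.refl = trans at-top (sym (trans (*-congʳ U≈) (trans (1-z-* top∈F) V↓+T₊≈1))) ,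
                   trans at-top
                     (sym (trans (*-congʳ U≈)
                     (trans (1-z-*-T top∈F)
                     (trans (+-congʳ (trans (*-congʳ V↓≈0) (trans (zeroˡ _) (sym V↓≈0))))
                     V↓+T₊≈1))))
      where
      at-top : when (top ≟ᶜ top) 1# ≈ 1#
      at-top = when-true (top ≟ᶜ top) ≡.refl

      U≈ : ∏ (applyUpTo f 1) 1-z ≈ 1-z (ρ top)
      U≈ = trans (*-identityʳ _)
        (reflexive (≡.cong 1-z (≡.trans (f≡ 0) (≡.trans (ℕ.+-identityʳ k) (≡.sym ρ≡k)))))

      V↓≈0 : V↓ top ≈ 0#
      V↓≈0 = when-false (inF? r b (0 , b 1)) λ { ((() , _) , _) }

      V↓+T₊≈1 : V↓ top + T 1 (suc (b 1)) ≈ 1#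
      V↓+T₊≈1 =
        trans (+-cong V↓≈0
        (trans (+-cong (when-true (1 ℕ.≟ 1) ≡.refl) (row-empty 1 (suc (b 1)) ℕ.≤-refl))
        (+-identityʳ 1#))) (+-identityˡ 1#)
    pathSum-closed (suc n) k u f u≈ f≡ {x@(i , c)} x∈F ρ≡k k+n≡M =
      (begin
        pathSum u x (just L)                    ≈⟨ by-moves (just L) ⟩
        (U′ * V↓ x) * 1# + U′ * T₊
          ≈⟨ solve 3 (λ U V T → (U :* V) :* con 1 :+ U :* T := U :* (V :+ T)) refl U′
          (V↓ x) T₊ ⟩
        U′ * (V↓ x + T₊)                        ≈⟨ *-congˡ (1-z-* x∈F) ⟨
        U′ * (1-z (ρ x) * V x)
          ≈⟨ solve 3 (λ U y V → U :* (y :* V) := (y :* U) :* V) refl U′ _ _ ⟩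
        (1-z (ρ x) * U′) * V x
          ≈⟨ *-congʳ (*-congʳ (reflexive (≡.cong 1-z ρ≡f0))) ⟩
        ∏ (applyUpTo f (suc (suc n))) 1-z * V x ∎) ,
      (begin
        pathSum u x (just R)                    ≈⟨ by-moves (just R) ⟩
        (U′ * V↓ x) * u zero + U′ * T₊
          ≈⟨ +-congʳ
          (*-congˡ (trans (u≈ zero)
          (reflexive (≡.cong z (≡.trans (ℕ.+-identityʳ k) (≡.sym ρ≡k)))))) ⟩
        (U′ * V↓ x) * z (ρ x) + U′ * T₊
          ≈⟨ solve 4 (λ U V z T → (U :* V) :* z :+ U :* T := U :* (V :* z :+ T)) refl U′
          (V↓ x) _ T₊ ⟩
        U′ * (V↓ x * z (ρ x) + T₊)              ≈⟨ *-congˡ (1-z-*-T x∈F) ⟨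
        U′ * (1-z (ρ x) * T i c)
          ≈⟨ solve 3 (λ U y V → U :* (y :* V) := (y :* U) :* V) refl U′ _ _ ⟩
        (1-z (ρ x) * U′) * T i c
          ≈⟨ *-congʳ (*-congʳ (reflexive (≡.cong 1-z ρ≡f0))) ⟩
        ∏ (applyUpTo f (suc (suc n))) 1-z * T i c ∎)
      where
      U′ = ∏ (applyUpTo (f ∘ suc) (suc n)) 1-z
      T₊ = T i (suc c)

      ρ≡f0 : ρ x ≡ f 0
      ρ≡f0 = ≡.trans ρ≡k (≡.sym (≡.trans (f≡ 0) (ℕ.+-identityʳ k)))

      IH : ∀ m → (y∈F : InF r b (move m x)) → _
      IH m y∈F = pathSum-closed n (suc k) (u ∘ suc) (f ∘ suc)
        (λ j → trans (u≈ (suc j)) (reflexive (≡.cong z (ℕ.+-suc k (toℕ j)))))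
        (λ a → ≡.trans (f≡ (suc a)) (ℕ.+-suc k a))
        y∈F (≡.trans (ρ-move m x∈F y∈F) (≡.cong suc ρ≡k)) (≡.trans (≡.sym (ℕ.+-suc k n)) k+n≡M)

      not-top : b i < suc c → i ≢ 1
      -- At the end of row 1 the cell would be the top, whose rank `M` leaves no letter, while
      -- `suc n` letters remain.
      not-top b<c ≡.refl =
        ℕ.<-irrefl
        (≡.trans (≡.sym ρ≡k) (≡.cong (_∸ 1) (ℕ.≤-antisym (proj₂ (proj₂ x∈F)) (ℕ.≤-pred b<c))))
        (≡.subst (k <_) k+n≡M (ℕ.m<m+n k (s≤s z≤n)))

      right : when (inF? r b (i , suc c)) (pathSum (u ∘ suc) (i , suc c) (just R) * 1#) ≈
        U′ * T₊
      right with ℕ.≤-<-connex (suc c) (b i)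
      ... | inj₁ c<b = trans (when-true (inF? r b (i , suc c)) y∈F)
        (trans (*-identityʳ _) (proj₂ (IH R y∈F)))
        where
        y∈F : InF r b (i , suc c)
        y∈F = proj₁ x∈F , ℕ.m≤n⇒m≤1+n (proj₁ (proj₂ x∈F)) , c<b
      ... | inj₂ b<c = trans (when-false (inF? r b (i , suc c)) (ℕ.<⇒≱ b<c ∘ proj₂ ∘ proj₂))
                       (sym (trans (*-congˡ (T-empty i (suc c) b<c (not-top b<c))) (zeroʳ U′)))

      left : ∀ a → when (inF? r b (move L x)) (pathSum (u ∘ suc) (move L x) (just L) * a) ≈
        (U′ * V↓ x) * a
      left a = trans (sym (when-* (inF? r b (move L x)))) (*-congʳ
        (trans (when-cong (inF? r b (move L x)) (λ y∈F → proj₁ (IH L y∈F)))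
          (sym (*-when (inF? r b (move L x))))))

      by-moves : ∀ σ → pathSum u x σ ≈ (U′ * V↓ x) * factor (u zero) σ L + U′ * T₊
      by-moves σ = trans (reflexive ∑-∷) (+-cong (left (factor (u zero) σ L))
        (trans (reflexive ∑-∷) (trans (+-congˡ (reflexive ∑-[])) (trans (+-identityʳ _)
          (trans (when-cong (inF? r b (i , suc c)) (λ _ → *-congˡ (reflexive (factor-R σ))))
            right)))))
        where
        factor-R : ∀ σ → factor (u zero) σ R ≡ 1#
        factor-R nothing  = ≡.refl
        factor-R (just L) = ≡.refl
        factor-R (just R) = ≡.refl

    -- Row `i` of `F` begins in column `i`, so `T i i` covers the whole row.
    ∑-T-diagonal : ∑ (upTo r) (λ i → T (suc i) (suc i)) ≈ 1# + ∑ (F r b) W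
    ∑-T-diagonal = trans (∑-+ (upTo r)) (+-cong
      (trans (∑-cong (upTo r) λ i → when-⇔ (suc i ℕ.≟ 1) (i ℕ.≟ 0) ℕ.suc-injective (≡.cong suc)
        (λ _ → refl)) (∑-upTo-delta 1≤r))
      (sym ∑-F-rows))

    totalPathSum-closed : (u : Fin (b 1 ∸ 1) → Carrier) → (∀ j → u j ≈ z (toℕ j)) →
      (1# + ∑ (F r b) W) * ∏ (upTo (suc (b 1 ∸ 1))) 1-z ≈ totalPathSum u
    totalPathSum-closed u u≈ = begin
      (1# + ∑ (F r b) W) * U                          ≈⟨ *-comm _ _ ⟩
      U * (1# + ∑ (F r b) W)                          ≈⟨ *-congˡ ∑-T-diagonal ⟨
      U * ∑ (upTo r) (λ i → T (suc i) (suc i))        ≈⟨ *-∑ U (upTo r) ⟩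
      ∑ (upTo r) (λ i → U * T (suc i) (suc i))
        ≈⟨ ∑-upTo-cong r
             (λ i i<r → trans (sym (proj₂ (pathSum-closed (b 1 ∸ 1) 0 u id u≈ (λ _ → ≡.refl)
             ((s≤s z≤n , i<r) , ℕ.≤-refl , i≤bᵢ (suc i) (s≤s z≤n) i<r) (ℕ.n∸n≡0 (suc i))
               ≡.refl)))
             (sym (pathSum-nothing u (suc i , suc i)))) ⟩
      totalPathSum u                                  ∎
      where U = ∏ (upTo (suc (b 1 ∸ 1))) 1-z

-- Polynomials and power series

-- Pairing a polynomial with an arbitrary function on exponent vectors is linear
-- and sees products as iterated pairings.

eval : ∀ {n} → Poly n → (Vec ℕ n → ℤ) → ℤ
eval p φ = foldr (λ (a , e) s → a ℤ.* φ e ℤ.+ s) 0ℤ p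

infix 4 _≋_
record _≋_ {n} (p p′ : Poly n) : Set where
  constructor pointwise
  field at : ∀ φ → eval p φ ≡ eval p′ φ
open _≋_

private
  variable
    m n : ℕ

  infixl 6 _⊕_
  _⊕_ : Vec ℕ n → Vec ℕ n → Vec ℕ n
  _⊕_ = zipWith Nat._+_

eval-cong : (p : Poly n) {φ ψ : Vec ℕ n → ℤ} → (∀ e → φ e ≡ ψ e) → eval p φ ≡ eval p ψ
eval-cong []            φ≗ψ = ≡.refl
eval-cong ((a , e) ∷ p) φ≗ψ = ≡.cong₂ (λ x y → a ℤ.* x ℤ.+ y) (φ≗ψ e) (eval-cong p φ≗ψ)

eval-++ : (p q : Poly n) (φ : Vec ℕ n → ℤ) → eval (p ++ q) φ ≡ eval p φ ℤ.+ eval q φ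
eval-++ []            q φ = ≡.sym (ℤ.+-identityˡ _)
eval-++ ((a , e) ∷ p) q φ = ≡.trans (≡.cong (ℤ._+_ (a ℤ.* φ e)) (eval-++ p q φ))
  (≡.sym (ℤ.+-assoc (a ℤ.* φ e) _ _))

eval-0 : (p : Poly n) → eval p (λ _ → 0ℤ) ≡ 0ℤ
eval-0 []            = ≡.refl
eval-0 ((a , e) ∷ p) = ≡.trans (≡.cong₂ ℤ._+_ (ℤ.*-zeroʳ a) (eval-0 p)) ≡.refl

eval-linear : ∀ a (p : Poly n) φ ψ → eval p (λ e → a ℤ.* φ e ℤ.+ ψ e) ≡ a ℤ.* eval p φ ℤ.+ eval
  p ψ
eval-linear a []            φ ψ = ≡.sym (≡.trans (ℤ.+-identityʳ _) (ℤ.*-zeroʳ a))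
eval-linear a ((c , e) ∷ p) φ ψ =
  ≡.trans (≡.cong (ℤ._+_ (c ℤ.* (a ℤ.* φ e ℤ.+ ψ e))) (eval-linear a p φ ψ))
  (identity a c (φ e) (ψ e) (eval p φ) (eval p ψ))
  where
  identity : ∀ a c x y s t → c ℤ.* (a ℤ.* x ℤ.+ y) ℤ.+ (a ℤ.* s ℤ.+ t) ≡
    a ℤ.* (c ℤ.* x ℤ.+ s) ℤ.+ (c ℤ.* y ℤ.+ t)
  identity = solve-∀

-- Fubini for two formal sums; commutativity of the product rests on it.
eval-swap : (p : Poly m) (q : Poly n) (φ : Vec ℕ m → Vec ℕ n → ℤ) →
            eval p (λ e → eval q (φ e)) ≡ eval q (λ e′ → eval p (λ e → φ e e′))
eval-swap []            q φ = ≡.sym (eval-0 q)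
eval-swap ((a , e) ∷ p) q φ = ≡.trans (≡.cong (ℤ._+_ (a ℤ.* eval q (φ e))) (eval-swap p q φ))
  (≡.sym (eval-linear a q (φ e) (λ e′ → eval p (λ e → φ e e′))))

eval-single : ∀ a (e : Vec ℕ n) φ → eval ((a , e) ∷ []) φ ≡ a ℤ.* φ e
eval-single a e φ = ℤ.+-identityʳ _

module _ {n : ℕ} where
  open RawRing (polyRing n) using (_*_; -_; 1#)

  eval-neg : ∀ p φ → eval (- p) φ ≡ ℤ.- eval p φ
  eval-neg []            φ = ≡.refl
  eval-neg ((a , e) ∷ p) φ = ≡.trans (≡.cong (ℤ._+_ (ℤ.- a ℤ.* φ e)) (eval-neg p φ))
    (identity a (φ e) (eval p φ))
    where
    identity : ∀ a x y → ℤ.- a ℤ.* x ℤ.+ ℤ.- y ≡ ℤ.- (a ℤ.* x ℤ.+ y)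
    identity = solve-∀

  -- This forces arbitrary test functions: even for an indicator `φ`, the inner pairing is a
  -- function of `e` that need not be an indicator.
  eval-* : ∀ p q φ → eval (p * q) φ ≡ eval p (λ e → eval q (λ e′ → φ (e ⊕ e′)))
  eval-* []            q φ = ≡.refl
  eval-* ((a , e) ∷ p) q φ = ≡.trans (eval-++ (map _ q) (p * q) φ)
    (≡.cong₂ ℤ._+_ (eval-term q) (eval-* p q φ))
    where
    identity : ∀ a c x y → (a ℤ.* c) ℤ.* x ℤ.+ a ℤ.* y ≡ a ℤ.* (c ℤ.* x ℤ.+ y)
    identity = solve-∀

    eval-term : ∀ q → eval (map (λ (a′ , e′) → a ℤ.* a′ , e ⊕ e′) q) φ ≡ a ℤ.* eval q
      (λ e′ → φ (e ⊕ e′))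
    eval-term []              = ≡.sym (ℤ.*-zeroʳ a)
    eval-term ((a′ , e′) ∷ q) =
      ≡.trans (≡.cong (ℤ._+_ ((a ℤ.* a′) ℤ.* φ (e ⊕ e′))) (eval-term q)) (identity a a′ _ _)

  eval-1# : ∀ φ → eval 1# φ ≡ φ (replicate n 0)
  eval-1# φ = ≡.trans (eval-single 1ℤ (replicate n 0) φ) (ℤ.*-identityˡ _)

  eval-var : ∀ i φ → eval (var {n} i) φ ≡ φ (replicate n 0 [ i ]≔ 1)
  eval-var i φ = ≡.trans (eval-single 1ℤ (replicate n 0 [ i ]≔ 1) φ) (ℤ.*-identityˡ _)

  ++-isAbelianGroup : IsAbelianGroup (_≋_ {n}) _++_ [] -_
  ++-isAbelianGroup = record
    { isGroup = record
      { isMonoid = record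
        { isSemigroup = record
          { isMagma = record
            { isEquivalence = record
              { refl  = pointwise λ φ → ≡.refl
              ; sym   = λ p≋q → pointwise λ φ → ≡.sym (at p≋q φ)
              ; trans = λ p≋q q≋s → pointwise λ φ → ≡.trans (at p≋q φ) (at q≋s φ)
              }
            ; ∙-cong = λ {p} {p′} {q} {q′} p≋p′ q≋q′ → pointwise λ φ → ≡.trans (eval-++ p q φ)
                (≡.trans (≡.cong₂ ℤ._+_ (at p≋p′ φ) (at q≋q′ φ)) (≡.sym (eval-++ p′ q′ φ)))
            }
          ; assoc = λ p q s → pointwise λ φ → ≡.cong (λ t → eval t φ) (List.++-assoc p q s)
          }
        ; identity =
          (λ p → pointwise λ φ → ≡.refl) , (λ p → pointwise λ φ →
          ≡.cong (λ t → eval t φ) (List.++-identityʳ p))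
        }
      ; inverse =
        (λ p → pointwise λ φ → ≡.trans (eval-++ (- p) p φ)
        (≡.trans (≡.cong (ℤ._+ eval p φ) (eval-neg p φ)) (ℤ.+-inverseˡ (eval p φ))))
                , (λ p → pointwise λ φ → ≡.trans (eval-++ p (- p) φ)
                  (≡.trans (≡.cong (ℤ._+_ (eval p φ)) (eval-neg p φ))
                  (ℤ.+-inverseʳ (eval p φ))))
      ; ⁻¹-cong = λ {p} {q} p≋q → pointwise λ φ →
        ≡.trans (eval-neg p φ) (≡.trans (≡.cong ℤ.-_ (at p≋q φ)) (≡.sym (eval-neg q φ)))
      }
    ; comm = λ p q → pointwise λ φ →
      ≡.trans (eval-++ p q φ) (≡.trans (ℤ.+-comm (eval p φ) (eval q φ)) (≡.sym (eval-++ q p φ)))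
    }

  *-distribʳ-++ : ∀ p q s → (q ++ s) * p ≋ q * p ++ s * p
  *-distribʳ-++ p q s = pointwise λ φ → ≡.trans (eval-* (q ++ s) p φ) (≡.trans (eval-++ q s _)
    (≡.sym (≡.trans (eval-++ (q * p) (s * p) φ) (≡.cong₂ ℤ._+_ (eval-* q p φ) (eval-* s p φ)))))

  *-comm′ : ∀ p q → p * q ≋ q * p
  *-comm′ p q = pointwise λ φ → ≡.trans (eval-* p q φ) (≡.trans (eval-swap p q _)
    (≡.trans (eval-cong q (λ e′ → eval-cong p λ e → ≡.cong φ (Vec.zipWith-comm ℕ.+-comm e e′)))
      (≡.sym (eval-* q p φ))))

  *-identityˡ′ : ∀ p → 1# * p ≋ p
  *-identityˡ′ p = pointwise λ φ →
    ≡.trans (eval-* 1# p φ) (≡.trans (eval-1# (λ e → eval p (λ e′ → φ (e ⊕ e′))))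
    (eval-cong p λ e → ≡.cong φ (Vec.zipWith-identityˡ ℕ.+-identityˡ e)))

  poly-isCommutativeRing : IsCommutativeRing (_≋_ {n}) _++_ _*_ -_ [] 1#
  poly-isCommutativeRing = record
    { isRing = record
      { +-isAbelianGroup = ++-isAbelianGroup
      ; *-cong = λ {p} {p′} {q} {q′} p≋p′ q≋q′ → pointwise λ φ → ≡.trans (eval-* p q φ) (≡.trans
          (≡.trans (at p≋p′ _) (eval-cong p′ λ e → at q≋q′ _)) (≡.sym (eval-* p′ q′ φ)))
      ; *-assoc = λ p q s → pointwise λ φ → ≡.trans (eval-* (p * q) s φ)
        (≡.trans (eval-* p q _) (≡.trans
          (eval-cong p λ e → ≡.trans
            (eval-cong q λ e′ → eval-cong s λ e″ →
              ≡.cong φ (Vec.zipWith-assoc ℕ.+-assoc e e′ e″))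
            (≡.sym (eval-* q s _)))
          (≡.sym (eval-* p (q * s) φ))))
      ; *-identity = *-identityˡ′ , λ p → trans (*-comm′ p 1#) (*-identityˡ′ p)
      ; distrib = (λ p q s → trans (*-comm′ p (q ++ s)) (trans (*-distribʳ-++ p q s)
                    (∙-cong (*-comm′ q p) (*-comm′ s p)))) , *-distribʳ-++
      }
    ; *-comm = *-comm′
    }
    where open IsAbelianGroup ++-isAbelianGroup using (trans; ∙-cong)

polynomials : ∀ n → CommutativeRingOn (polyRing n)
polynomials n = record { _≈_ = _≋_ ; isCommutativeRing = poly-isCommutativeRing }

-- Pairing with the indicator function of e extracts the coefficient of e.

≋⇒≈ : {p q : Poly n} → p ≋ q → RawRing._≈_ (polyRing n) p q
≋⇒≈ {n} {p} {q} p≋q e = ≡.trans (coeff≡eval p) (≡.trans (at p≋q _) (≡.sym (coeff≡eval q)))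
  where
  _≟ᵉ_ = Vec.≡-dec {n = n} ℕ._≟_

  coeff≡eval : ∀ p → coeff p e ≡ eval p (λ e′ → if does (e′ ≟ᵉ e) then 1ℤ else 0ℤ)
  coeff≡eval [] = ≡.refl
  coeff≡eval ((a , e′) ∷ p) with does (e′ ≟ᵉ e)
  ... | true  = ≡.cong₂ ℤ._+_ (≡.sym (ℤ.*-identityʳ a)) (coeff≡eval p)
  ... | false =
    ≡.trans (coeff≡eval p) (≡.sym (≡.trans (≡.cong (ℤ._+ _) (ℤ.*-zeroʳ a)) (ℤ.+-identityˡ _)))

module Series {c ℓ} {S : RawRing c ℓ} (E : CommutativeRingOn S) where
  open Sums E
  open import Algebra.Properties.CommutativeSemigroup +-commutativeSemigroup using (x∙yz≈y∙xz)

  private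
    variable
      f g h f′ g′ : ℕ → Carrier

  infix 4 _≈ˢ_
  _≈ˢ_ : (ℕ → Carrier) → (ℕ → Carrier) → Set ℓ
  f ≈ˢ g = ∀ n → f n ≈ g n

  opaque
    unfolding ∑

    infixl 7 _⊛_
    _⊛_ : (ℕ → Carrier) → (ℕ → Carrier) → (ℕ → Carrier)
    _⊛_ = RawRing._*_ (seriesRing S)

    ⊛-def : RawRing._*_ (seriesRing S) f g ≡ f ⊛ g
    ⊛-def = ≡.refl

    ⊛-zero : (f ⊛ g) 0 ≈ f 0 * g 0
    ⊛-zero = +-identityʳ _

    -- Splitting off the first term turns commutativity and associativity into inductions on the
    -- degree, with a shifted `f` and without double sums.
    ⊛-suc : ∀ n → (f ⊛ g) (suc n) ≈ f 0 * g (suc n) + (f ∘ suc ⊛ g) n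
    ⊛-suc n = reflexive (∑-upTo-suc (suc n))

    ⊛-distribˡ : ∀ f g h → f ⊛ (λ n → g n + h n) ≈ˢ (λ n → (f ⊛ g) n + (f ⊛ h) n)
    ⊛-distribˡ f g h n = trans (∑-cong (upTo (suc n)) (λ k → distribˡ (f k) _ _))
      (∑-+ (upTo (suc n)))

    ⊛-cong : f ≈ˢ f′ → g ≈ˢ g′ → f ⊛ g ≈ˢ f′ ⊛ g′
    ⊛-cong f≈ g≈ n = ∑-cong (upTo (suc n)) λ k → *-cong (f≈ k) (g≈ (n ∸ k))

    ⊛-scale : ∀ a f g → (λ n → a * f n) ⊛ g ≈ˢ (λ n → a * (f ⊛ g) n)
    ⊛-scale a f g n = trans (∑-cong (upTo (suc n)) λ k → *-assoc a (f k) _)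
      (sym (*-∑ a (upTo (suc n))))

    ⊛-zeroˡ : ∀ g → (λ _ → 0#) ⊛ g ≈ˢ (λ _ → 0#)
    ⊛-zeroˡ g n = ∑-0# (upTo (suc n)) λ k → zeroˡ _

  -- The mirror image of `⊛-suc`, splitting off the last term; the two together give commutativity.
  ⊛-sucʳ : ∀ f g n → (f ⊛ g) (suc n) ≈ f (suc n) * g 0 + (f ⊛ g ∘ suc) n
  ⊛-sucʳ f g zero = trans (⊛-suc 0) (trans (+-cong (sym ⊛-zero) ⊛-zero) (+-comm _ _))
  ⊛-sucʳ f g (suc n) = begin
    (f ⊛ g) (suc (suc n))
      ≈⟨ ⊛-suc (suc n) ⟩
    f 0 * g (suc (suc n)) + (f ∘ suc ⊛ g) (suc n)
      ≈⟨ +-congˡ (⊛-sucʳ (f ∘ suc) g n) ⟩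
    f 0 * g (suc (suc n)) + (f (suc (suc n)) * g 0 + (f ∘ suc ⊛ g ∘ suc) n)
      ≈⟨ x∙yz≈y∙xz _ _ _ ⟩
    f (suc (suc n)) * g 0 + (f 0 * g (suc (suc n)) + (f ∘ suc ⊛ g ∘ suc) n)
      ≈⟨ +-congˡ (⊛-suc n) ⟨
    f (suc (suc n)) * g 0 + (f ⊛ g ∘ suc) (suc n)                                ∎

  ⊛-comm : ∀ f g → f ⊛ g ≈ˢ g ⊛ f
  ⊛-comm f g zero    = trans ⊛-zero (trans (*-comm _ _) (sym ⊛-zero))
  ⊛-comm f g (suc n) =
    trans (⊛-suc n) (trans (+-cong (*-comm _ _) (⊛-comm (f ∘ suc) g n)) (sym (⊛-sucʳ g f n)))

  ⊛-distribʳ : ∀ f g h → (λ n → g n + h n) ⊛ f ≈ˢ (λ n → (g ⊛ f) n + (h ⊛ f) n)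
  ⊛-distribʳ f g h n =
    trans (⊛-comm _ f n) (trans (⊛-distribˡ f g h n) (+-cong (⊛-comm f g n) (⊛-comm f h n)))

  ⊛-assoc : ∀ f g h → (f ⊛ g) ⊛ h ≈ˢ f ⊛ (g ⊛ h)
  ⊛-assoc f g h zero = begin
    ((f ⊛ g) ⊛ h) 0        ≈⟨ trans ⊛-zero (*-congʳ ⊛-zero) ⟩
    (f 0 * g 0) * h 0      ≈⟨ *-assoc _ _ _ ⟩
    f 0 * (g 0 * h 0)      ≈⟨ trans ⊛-zero (*-congˡ ⊛-zero) ⟨
    (f ⊛ (g ⊛ h)) 0        ∎
  ⊛-assoc f g h (suc n) = begin
    ((f ⊛ g) ⊛ h) (suc n)
      ≈⟨ ⊛-suc n ⟩
    (f ⊛ g) 0 * h (suc n) + ((f ⊛ g) ∘ suc ⊛ h) n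
      -- By `⊛-suc`, the shift of `f ⊛ g` is `f 0` times the shift of `g`, plus the shift of `f`
      -- times `g`.
      ≈⟨ +-cong (trans (*-congʳ ⊛-zero) (*-assoc _ _ _))
           (trans (⊛-cong ⊛-suc (λ _ → refl) n) (⊛-distribʳ h _ _ n)) ⟩
    f 0 * (g 0 * h (suc n)) + (((λ k → f 0 * g (suc k)) ⊛ h) n + ((f ∘ suc ⊛ g) ⊛ h) n)
      ≈⟨ +-congˡ (+-cong (⊛-scale (f 0) (g ∘ suc) h n) (⊛-assoc (f ∘ suc) g h n)) ⟩
    f 0 * (g 0 * h (suc n)) + (f 0 * (g ∘ suc ⊛ h) n + (f ∘ suc ⊛ (g ⊛ h)) n)
      ≈⟨ +-assoc _ _ _ ⟨
    (f 0 * (g 0 * h (suc n)) + f 0 * (g ∘ suc ⊛ h) n) + (f ∘ suc ⊛ (g ⊛ h)) n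
      ≈⟨ +-congʳ (trans (sym (distribˡ (f 0) _ _)) (*-congˡ (sym (⊛-suc n)))) ⟩
    f 0 * (g ⊛ h) (suc n) + (f ∘ suc ⊛ (g ⊛ h)) n
      ≈⟨ ⊛-suc n ⟨
    (f ⊛ (g ⊛ h)) (suc n) ∎

  ⊛-identityˡ : ∀ f → RawRing.1# (seriesRing S) ⊛ f ≈ˢ f
  ⊛-identityˡ f zero    = trans ⊛-zero (*-identityˡ _)
  ⊛-identityˡ f (suc n) =
    trans (⊛-suc n) (trans (+-cong (*-identityˡ _) (⊛-zeroˡ f n)) (+-identityʳ _))

  opaque
    unfolding _⊛_

    series-isCommutativeRing : IsCommutativeRing _≈ˢ_
      (RawRing._+_ (seriesRing S)) (RawRing._*_ (seriesRing S)) (RawRing.-_ (seriesRing S))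
      (RawRing.0# (seriesRing S)) (RawRing.1# (seriesRing S))
    series-isCommutativeRing = record
      { isRing = record
        { +-isAbelianGroup = record
          { isGroup = record
            { isMonoid = record
              { isSemigroup = record
                { isMagma = record
                  { isEquivalence = record
                    { refl  = λ _ → refl
                    ; sym   = λ f≈g n → sym (f≈g n)
                    ; trans = λ f≈g g≈h n → trans (f≈g n) (g≈h n)
                    }
                  ; ∙-cong = λ f≈f′ g≈g′ n → +-cong (f≈f′ n) (g≈g′ n)
                  }
                ; assoc = λ f g h n → +-assoc (f n) (g n) (h n)
                }
              ; identity = (λ f n → +-identityˡ (f n)) , (λ f n → +-identityʳ (f n))
              }
            ; inverse = (λ f n → -‿inverseˡ (f n)) , (λ f n → -‿inverseʳ (f n))
            ; ⁻¹-cong = λ f≈g n → -‿cong (f≈g n)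
            }
          ; comm = λ f g n → +-comm (f n) (g n)
          }
        ; *-cong     = ⊛-cong
        ; *-assoc    = ⊛-assoc
        ; *-identity = ⊛-identityˡ , λ f n → trans (⊛-comm f _ n) (⊛-identityˡ f n)
        ; distrib    = ⊛-distribˡ , ⊛-distribʳ
        }
      ; *-comm = ⊛-comm
      }

  series : CommutativeRingOn (seriesRing S)
  series = record { _≈_ = _≈ˢ_ ; isCommutativeRing = series-isCommutativeRing }

-- Monomials and substitution

module Monomials {c ℓ} {S : RawRing c ℓ} (E : CommutativeRingOn S) where
  open Sums E

  monomial : (Fin n → Carrier) → Vec ℕ n → Carrier
  monomial {n} f e = ∏ (allFin n) (λ i → f i ^ lookup e i)

  ∏-tabulate : {X : Set} (h : Fin n → X) (f : X → Carrier) → ∏ (tabulate h) f ≡ ∏ (allFin n)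
    (f ∘ h)
  ∏-tabulate {zero}  h f = ≡.refl
  ∏-tabulate {suc n} h f = ≡.cong (f (h zero) *_)
    (≡.trans (∏-tabulate (h ∘ suc) f) (≡.sym (∏-tabulate suc (f ∘ h))))

  monomial-∷ : (f : Fin (suc n) → Carrier) (k : ℕ) (e : Vec ℕ n) →
               monomial f (k ∷ e) ≡ f zero ^ k * monomial (f ∘ suc) e
  monomial-∷ f k e = ≡.cong (f zero ^ k *_) (∏-tabulate suc (λ i → f i ^ lookup (k ∷ e) i))

  monomial-replicate-0 : (f : Fin n → Carrier) → monomial f (replicate n 0) ≈ 1#
  monomial-replicate-0 {zero}  f = refl
  monomial-replicate-0 {suc n} f = trans (reflexive (monomial-∷ f 0 (replicate n 0)))
    (trans (*-identityˡ _) (monomial-replicate-0 (f ∘ suc)))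

  monomial-var : (f : Fin n → Carrier) (e : Vec ℕ n) (j : Fin n) →
    monomial f (zipWith Nat._+_ e (replicate n 0 [ j ]≔ 1)) ≈ monomial f e * f j
  monomial-var {suc n} f (k ∷ e) zero = begin
    monomial f (k Nat.+ 1 ∷ zipWith Nat._+_ e (replicate n 0))
      ≡⟨ ≡.cong (monomial f)
           (≡.cong₂ _∷_ (ℕ.+-comm k 1) (Vec.zipWith-identityʳ ℕ.+-identityʳ e)) ⟩
    monomial f (suc k ∷ e)                           ≡⟨ monomial-∷ f (suc k) e ⟩
    (f zero * f zero ^ k) * monomial (f ∘ suc) e     ≈⟨ trans (*-assoc _ _ _) (*-comm _ _) ⟩
    (f zero ^ k * monomial (f ∘ suc) e) * f zero     ≡⟨ ≡.cong (_* f zero) (monomial-∷ f k e) ⟨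
    monomial f (k ∷ e) * f zero                      ∎
  monomial-var {suc n} f (k ∷ e) (suc j) = begin
    monomial f (k Nat.+ 0 ∷ e′)                      ≡⟨ monomial-∷ f (k Nat.+ 0) e′ ⟩
    f zero ^ (k Nat.+ 0) * monomial (f ∘ suc) e′
      ≈⟨ *-cong (reflexive (≡.cong (f zero ^_) (ℕ.+-identityʳ k)))
      (monomial-var (f ∘ suc) e j) ⟩
    f zero ^ k * (monomial (f ∘ suc) e * f (suc j))  ≈⟨ *-assoc _ _ _ ⟨
    (f zero ^ k * monomial (f ∘ suc) e) * f
      (suc j)  ≡⟨ ≡.cong (_* f (suc j)) (monomial-∷ f k e) ⟨
    monomial f (k ∷ e) * f (suc j)                   ∎
    where e′ = zipWith Nat._+_ e (replicate n 0 [ j ]≔ 1)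

module _ {m n : ℕ} (f : Fin n → Poly m) where
  open Monomials (polynomials m)
  open RawRing (polyRing m) using () renaming (_*_ to _*ᵐ_; 1# to 1ᵐ)
  open RawRing (polyRing n) using () renaming (_*_ to _*ⁿ_; 1# to 1ⁿ)

  -- Substitution transposed to test functions. The right-hand side sees `p` only through a pairing,
  -- so `substitute f` respects `≋`.
  eval-substitute : ∀ p φ → eval (substitute f p) φ ≡ eval p (λ e → eval (monomial f e) φ)
  eval-substitute [] φ = ≡.refl
  eval-substitute ((a , e) ∷ p) φ =
    ≡.trans (eval-++ (const a *ᵐ monomial f e) (substitute f p) φ)
    (≡.cong₂ ℤ._+_
      (≡.trans (eval-* (const a) (monomial f e) φ)
        (≡.trans (eval-single a (replicate m 0)
        (λ e′ → eval (monomial f e) (λ e″ → φ (zipWith Nat._+_ e′ e″))))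
        (≡.cong (ℤ._*_ a) (eval-cong (monomial f e) λ e′ →
          ≡.cong φ (Vec.zipWith-identityˡ ℕ.+-identityˡ e′)))))
      (eval-substitute p φ))

  substitute-cong : ∀ {p q} → p ≋ q → substitute f p ≋ substitute f q
  substitute-cong {p} {q} p≋q = pointwise λ φ →
    ≡.trans (eval-substitute p φ) (≡.trans (at p≋q _) (≡.sym (eval-substitute q φ)))

  substitute-++ : ∀ p q → substitute f (p ++ q) ≋ substitute f p ++ substitute f q
  substitute-++ p q = pointwise λ φ → ≡.trans (eval-substitute (p ++ q) φ)
    (≡.trans (eval-++ p q _)
    (≡.sym (≡.trans (eval-++ (substitute f p) (substitute f q) φ)
      (≡.cong₂ ℤ._+_ (eval-substitute p φ) (eval-substitute q φ)))))

  substitute-1# : substitute f 1ⁿ ≋ 1ᵐ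
  substitute-1# = pointwise λ φ → ≡.trans (eval-substitute 1ⁿ φ)
    (≡.trans (eval-1# {n} (λ e → eval (monomial f e) φ)) (at (monomial-replicate-0 f) φ))

  substitute-*-var : ∀ j p → substitute f (p *ⁿ var j) ≋ substitute f p *ᵐ f j
  substitute-*-var j p = pointwise λ φ → ≡.trans (eval-substitute (p *ⁿ var j) φ)
    (≡.trans (eval-* p (var j) _)
    (≡.trans (eval-cong p λ e →
      ≡.trans (eval-var j (λ e′ → eval (monomial f (zipWith Nat._+_ e e′)) φ))
      (≡.trans (at (monomial-var f e j) φ) (eval-* (monomial f e) (f j) φ)))
    (≡.sym (≡.trans (eval-* (substitute f p) (f j) φ) (eval-substitute p _)))))

-- The multichain series in t

module Multichains {c ℓ} {S : RawRing c ℓ} (E : CommutativeRingOn S) (q : RawRing.Carrier S)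
    {r : ℕ} {b : ℕ → ℕ} (shape : FerrersShape r b) where
  open Sums E
  open FerrersShape shape
  open Series E using (series; _⊛_; ⊛-def; ⊛-zero; ⊛-suc; ⊛-zeroˡ)
  open RawRing (seriesRing S) using () renaming (_*_ to _*ˢ_)
  private module K = Sums series

  -- The series q^a t, written with the conditional of `_t^_` so that over polynomials both agree by
  -- computation.
  tq^ : ℕ → (ℕ → Carrier)
  tq^ a k = if does (k ℕ.≟ 1) then q ^ a else 0#

  tq^-*-zero : ∀ a f → (tq^ a *ˢ f) 0 ≈ 0#
  tq^-*-zero a f = trans (reflexive (≡.cong (λ g → g 0) ⊛-def))
    (trans (⊛-zero {tq^ a} {f}) (zeroˡ (f 0)))

  tq^-*-suc : ∀ a f n → (tq^ a *ˢ f) (suc n) ≈ q ^ a * f n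
  tq^-*-suc a f n = trans (reflexive (≡.cong (λ g → g (suc n)) ⊛-def))
    (trans (⊛-suc n) (trans (+-cong (zeroˡ _) (constant n)) (+-identityˡ _)))
    where
    constant : ∀ n → (tq^ a ∘ suc ⊛ f) n ≈ q ^ a * f n
    constant zero    = ⊛-zero {tq^ a ∘ suc} {f}
    constant (suc n) = trans (⊛-suc n) (trans (+-congˡ (⊛-zeroˡ f n)) (+-identityʳ _))

  ∑-at : ∀ {X : Set} (xs : List X) {f : X → (ℕ → Carrier)} m → K.∑ xs f m ≈ ∑ xs (λ x → f x m)
  ∑-at []       m = trans (K.reflexive K.∑-[] m) (reflexive (≡.sym ∑-[]))
  ∑-at (x ∷ xs) m = trans (K.reflexive K.∑-∷ m)
    (trans (+-congˡ (∑-at xs m)) (reflexive (≡.sym ∑-∷)))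

  when-at : ∀ {P : Set} (P? : Dec P) {f : ℕ → Carrier} m → K.when P? f m ≈ when P? (f m)
  when-at P?@(yes p) m = trans (K.when-true P? p m) (sym (when-true P? p))
  when-at P?@(no ¬p) m = trans (K.when-false P? ¬p m) (sym (when-false P? ¬p))

  ^-+ : ∀ a c → q ^ (a Nat.+ c) ≈ q ^ a * q ^ c
  ^-+ zero    c = sym (*-identityˡ (q ^ c))
  ^-+ (suc a) c = trans (*-congˡ (^-+ a c)) (sym (*-assoc _ _ _))

  weight : Vec Cell m → Carrier
  weight v = q ^ Vec.sum (Vec.map ρ v)

  A : ℕ → Carrier
  A m = ∑ (filter (linked? _≼?_) (tuples (F r b) m)) weight

  -- `x` only bounds the chain from below: it adds neither to the length `m` nor to the weight.
  V : Cell → (ℕ → Carrier)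
  V x m = ∑ (tuples (F r b) m) (λ v → when (linked? _≼?_ (x ∷ v)) (weight v))

  open ZetaNumerator series shape tq^ V

  weight-∷ : ∀ y m → ∑ (tuples (F r b) m) (λ v → when (linked? _≼?_ (y ∷ v)) (weight (y ∷ v))) ≈
    q ^ ρ y * V y m
  weight-∷ y m = trans
    (∑-cong (tuples (F r b) m) λ v →
      trans (when-cong (linked? _≼?_ (y ∷ v)) λ _ → ^-+ (ρ y) (Vec.sum (Vec.map ρ v)))
                                           (sym (*-when (linked? _≼?_ (y ∷ v)))))
    (sym (*-∑ (q ^ ρ y) (tuples (F r b) m)))

  -- Linkedness compares neighbours only, so once the first element `y` is split off, the bound `x`
  -- concerns `y` alone.
  V-suc : ∀ x m → V x (suc m) ≈ ∑ (F r b) (λ y → when (x ≼? y) (q ^ ρ y * V y m))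
  V-suc x m = trans (∑-cartesianProductWith _∷_ (F r b) (tuples (F r b) m))
    (∑-cong (F r b) λ y → begin
    ∑ (tuples (F r b) m) (λ v → when (linked? _≼?_ (x ∷ y ∷ v)) (weight (y ∷ v)))
      ≈⟨ ∑-cong (tuples (F r b) m) (λ v → trans
           (when-⇔ (linked? _≼?_ (x ∷ y ∷ v)) (x ≼? y ×-dec linked? _≼?_ (y ∷ v))
             (λ { (x≼y Linked.∷ chain) → x≼y , chain })
               (λ { (x≼y , chain) → x≼y Linked.∷ chain }) (λ _ → refl))
           (when-× (x ≼? y) (linked? _≼?_ (y ∷ v)))) ⟩
    ∑ (tuples (F r b) m) (λ v → when (x ≼? y) (when (linked? _≼?_ (y ∷ v)) (weight (y ∷ v))))
      ≈⟨ when-∑ (x ≼? y) (tuples (F r b) m) ⟨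
    when (x ≼? y) (∑ (tuples (F r b) m) (λ v → when (linked? _≼?_ (y ∷ v)) (weight (y ∷ v))))
      ≈⟨ when-cong (x ≼? y) (λ _ → weight-∷ y m) ⟩
    when (x ≼? y) (q ^ ρ y * V y m) ∎)

  ∑-single : {X : Set} {x : X} {f : X → Carrier} → ∑ (x ∷ []) f ≈ f x
  ∑-single = trans (reflexive ∑-∷) (trans (+-congˡ (reflexive ∑-[])) (+-identityʳ _))

  -- Degree 0 is the empty multichain; in higher degree the first element `y` accounts for the
  -- factor q^(ρ y) t, which lowers the degree by one.
  V-rec : ∀ {x} → InF r b x → V x K.≈ (K.1# K.+ K.∑ (F r b) (λ y → K.when (x ≼? y) (W y)))
  V-rec {x} _ zero = trans ∑-single (trans (when-true (linked? _≼?_ (x ∷ [])) Linked.[-])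
    (sym (trans (+-congˡ (trans (∑-at (F r b) 0) (∑-0# (F r b) λ y →
      trans (when-at (x ≼? y) 0) (trans (when-cong (x ≼? y) λ _ → tq^-*-zero (ρ y) (V y))
        (when-0# (x ≼? y)))))) (+-identityʳ _))))
  V-rec {x} _ (suc m) =
    trans (V-suc x m)
    (sym (trans (+-identityˡ _) (trans (∑-at (F r b) (suc m)) (∑-cong (F r b) λ y →
    trans (when-at (x ≼? y) (suc m)) (when-cong (x ≼? y) λ _ → tq^-*-suc (ρ y) (V y) m)))))

  A-rec : A K.≈ (K.1# K.+ K.∑ (F r b) W)
  A-rec zero = trans (∑-filter (linked? _≼?_) (tuples (F r b) 0))
    (trans ∑-single (trans (when-true (linked? _≼?_ []) Linked.[])
      (sym (trans (+-congˡ (trans (∑-at (F r b) 0) (∑-0# (F r b) λ y → tq^-*-zero (ρ y) (V y))))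
        (+-identityʳ _)))))
  A-rec (suc m) = begin
    A (suc m)
      ≈⟨ ∑-filter (linked? _≼?_) (tuples (F r b) (suc m)) ⟩
    ∑ (tuples (F r b) (suc m)) (λ v → when (linked? _≼?_ v) (weight v))
      ≈⟨ ∑-cartesianProductWith _∷_ (F r b) (tuples (F r b) m) ⟩
    ∑ (F r b) (λ y → ∑ (tuples (F r b) m) (λ v → when (linked? _≼?_ (y ∷ v)) (weight (y ∷ v))))
      ≈⟨ ∑-cong (F r b) (λ y → trans (weight-∷ y m) (sym (tq^-*-suc (ρ y) (V y) m))) ⟩
    ∑ (F r b) (λ y → W y (suc m))
      ≈⟨ trans (+-identityˡ _) (∑-at (F r b) (suc m)) ⟨
    (K.1# K.+ K.∑ (F r b) W) (suc m)                     ∎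

  A*∏≈totalPathSum : (A *ˢ K.∏ (upTo (suc (b 1 ∸ 1))) 1-z) K.≈
                     PathSums.totalPathSum series r b (λ j → tq^ (toℕ {b 1 ∸ 1} j))
  A*∏≈totalPathSum = K.trans (K.*-congʳ A-rec) (totalPathSum-closed V-rec _ (λ _ → K.refl))

maximum-≤ : ∀ {k} (xs : List Cell) → All (λ x → ρ x ≤ k) xs → foldr _⊔_ 0 (map ρ xs) ≤ k
maximum-≤ []       []           = z≤n
maximum-≤ (x ∷ xs) (x≤k ∷ xs≤k) = ℕ.⊔-lub x≤k (maximum-≤ xs xs≤k)

≤-maximum : ∀ {x} {xs : List Cell} → x ∈ xs → ρ x ≤ foldr _⊔_ 0 (map ρ xs)
≤-maximum (here ≡.refl) = ℕ.m≤m⊔n _ _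
≤-maximum (there x∈xs)  = ℕ.m≤n⇒m≤o⊔n _ (≤-maximum x∈xs)

InF⇒∈F : ∀ {r b x} → InF r b x → x ∈ F r b
InF⇒∈F {r} {b} {i , c} x∈F@((_ , i≤r) , (_ , c≤b)) = ∈.∈-filter⁺ (inF? r b)
  (∈.∈-concatMap⁺ (λ i → map (i ,_) (upTo (suc (b i))))
    (Any.map (λ { ≡.refl → ∈.∈-map⁺ (i ,_) (∈.∈-upTo⁺ (s≤s c≤b)) }) (∈.∈-upTo⁺ (s≤s i≤r)))) x∈F

-- The factors in the definition of the numerator are hence exactly those with a = 0, ..., M, as in
-- `totalPathSum-closed`.
maxRank≡M : ∀ {r b} → FerrersShape r b → QZeta.maxRank (F r b) _≼?_ ρ ≡ b 1 ∸ 1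
maxRank≡M {r} {b} shape = ℕ.≤-antisym
  (maximum-≤ (F r b)
    (All.map ρ≤M
    (All.all-filter (inF? r b)
    (concatMap (λ i → map (i ,_) (upTo (suc (b i)))) (upTo (suc r))))))
  (≤-maximum (InF⇒∈F {r} {b} top∈F))
  where open FerrersShape shape

-- From polynomials in q and t to power series in t

private
  module ℤ[q] = Sums (polynomials 1)
  module ℤ[q,t] = Sums (polynomials 2)
  module ℤ[q][[t]] = Sums (Series.series (polynomials 1))

eval-var-* : (i : Fin n) (p : Poly n) (φ : Vec ℕ n → ℤ) →
  eval (RawRing._*_ (polyRing n) (var i) p) φ ≡
             eval p (λ e → φ (zipWith Nat._+_ (replicate n 0 [ i ]≔ 1) e))
eval-var-* {n} i p φ = ≡.trans (eval-* (var i) p φ)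
  (eval-var i (λ e → eval p (λ e′ → φ (zipWith Nat._+_ e e′))))

eval-var-^ : ∀ n j (φ : Vec ℕ (suc n) → ℤ) → eval (BigOps._^_ (polyRing (suc n)) (var zero) j)
  φ ≡ φ (j ∷ replicate n 0)
eval-var-^ n zero    φ = eval-1# φ
eval-var-^ n (suc j) φ =
  ≡.trans (eval-var-* zero (BigOps._^_ (polyRing (suc n)) (var zero) j) φ)
  (≡.trans (eval-var-^ n j (λ e → φ (zipWith Nat._+_ (1 ∷ replicate n 0) e)))
    (≡.cong (λ e → φ (suc j ∷ e)) (Vec.zipWith-identityˡ ℕ.+-identityˡ (replicate n 0))))

-- The transpose of taking the coefficient of t^m: `φ` is extended by zero to all other exponents of
-- t.
section : ℕ → (Vec ℕ 1 → ℤ) → (Vec ℕ 2 → ℤ)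
section m φ (i ∷ j ∷ []) = if does (j ℕ.≟ m) then φ (i ∷ []) else 0ℤ

eval-toSeries : ∀ p m φ → eval (toSeries p m) φ ≡ eval p (section m φ)
eval-toSeries [] m φ = ≡.refl
eval-toSeries ((a , i ∷ j ∷ []) ∷ p) m φ with does (j ℕ.≟ m)
... | true  = ≡.cong (ℤ._+_ (a ℤ.* φ (i ∷ []))) (eval-toSeries p m φ)
... | false = ≡.trans (eval-toSeries p m φ)
  (≡.sym (≡.trans (≡.cong (ℤ._+ _) (ℤ.*-zeroʳ a)) (ℤ.+-identityˡ _)))

toSeries-cong : ∀ {p p′} → p ≋ p′ → toSeries p ℤ[q][[t]].≈ toSeries p′
toSeries-cong {p} {p′} p≋p′ m = pointwise λ φ → ≡.trans (eval-toSeries p m φ)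
  (≡.trans (at p≋p′ _) (≡.sym (eval-toSeries p′ m φ)))

toSeries-++ : ∀ p p′ → toSeries (p ++ p′) ℤ[q][[t]].≈ (toSeries p ℤ[q][[t]].+ toSeries p′)
toSeries-++ p p′ m = pointwise λ φ → ≡.trans (eval-toSeries (p ++ p′) m φ)
  (≡.trans (eval-++ p p′ _)
  (≡.sym (≡.trans (eval-++ (toSeries p m) (toSeries p′ m) φ)
    (≡.cong₂ ℤ._+_ (eval-toSeries p m φ) (eval-toSeries p′ m φ)))))

toSeries-1# : toSeries (ℤ[q,t].1#) ℤ[q][[t]].≈ ℤ[q][[t]].1#
toSeries-1# zero    = pointwise λ φ → ≡.refl
toSeries-1# (suc m) = pointwise λ φ → ≡.refl

module _ {r : ℕ} {b : ℕ → ℕ} (shape : FerrersShape r b) where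
  open Multichains (polynomials 1) (var zero) shape

  toSeries-*-tqPower : ∀ {M} (j : Fin M) p →
    toSeries (p ℤ[q,t].* tqPower j) ℤ[q][[t]].≈ (toSeries p ℤ[q][[t]].* tq^ (toℕ j))
  toSeries-*-tqPower j p m = ℤ[q].trans (shift m) (ℤ[q][[t]].*-comm (tq^ k) (toSeries p) m)
    where
    k = toℕ j
  
    eval-tqPower : ∀ φ → eval (tqPower j) φ ≡ φ (k ∷ 1 ∷ [])
    eval-tqPower φ = ≡.trans (eval-var-* (suc zero) (BigOps._^_ (polyRing 2) (var zero) k) φ)
      (eval-var-^ 1 k (λ e → φ (zipWith Nat._+_ (0 ∷ 1 ∷ []) e)))

    eval-shift : ∀ m φ → eval (toSeries (p ℤ[q,t].* tqPower j) m) φ ≡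
      eval p (λ e → section m φ (zipWith Nat._+_ e (k ∷ 1 ∷ [])))
    eval-shift m φ = ≡.trans (eval-toSeries (p ℤ[q,t].* tqPower j) m φ)
      (≡.trans (eval-* p (tqPower j) _)
      (eval-cong p λ e → eval-tqPower (λ e′ → section m φ (zipWith Nat._+_ e e′))))
  
    shift : ∀ m → toSeries (p ℤ[q,t].* tqPower j) m ≋ (tq^ k ℤ[q][[t]].* toSeries p) m
    -- After multiplication by t q^k no exponent of t is 0, so every term misses the support of the
    -- test function.
    shift zero =
      ℤ[q].trans
      (pointwise λ φ → ≡.trans (eval-shift zero φ)
      (≡.trans (eval-cong p (vanish φ)) (eval-0 p)))
                   (ℤ[q].sym (tq^-*-zero k (toSeries p)))
      where
      vanish : ∀ φ e → section 0 φ (zipWith Nat._+_ e (k ∷ 1 ∷ [])) ≡ 0ℤ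
      vanish φ (i ∷ l ∷ []) rewrite ℕ.+-comm l 1 = ≡.refl
    shift (suc m) =
      ℤ[q].trans
      (pointwise λ φ → ≡.trans (eval-shift (suc m) φ) (≡.trans (eval-cong p (lower φ))
                     (≡.sym (≡.trans (eval-* ((var zero ℤ[q].^ k)) (toSeries p m) φ)
                       (≡.trans (eval-var-^ 0 k
                       (λ e → eval (toSeries p m) (λ e′ → φ (zipWith Nat._+_ e e′))))
                       (eval-toSeries p m _))))))
                   (ℤ[q].sym (tq^-*-suc k (toSeries p) m))
      where
      lower : ∀ φ e → section (suc m) φ (zipWith Nat._+_ e (k ∷ 1 ∷ [])) ≡
        section m (λ e′ → φ (zipWith Nat._+_ (k ∷ []) e′)) e
      lower φ (i ∷ l ∷ []) rewrite ℕ.+-comm l 1 | ℕ.+-comm i k = ≡.refl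

  numerator≈totalPathSum : qZetaNumerator r b ℤ[q][[t]].≈
    PathSums.totalPathSum (Series.series (polynomials 1)) r b (λ j → tq^ (toℕ {b 1 ∸ 1} j))
  numerator≈totalPathSum =
    K.trans (K.reflexive
    (≡.cong (λ H → QZeta.A (F r b) _≼?_ ρ K.* K.∏ (upTo (suc H)) (λ a → K.1# K.+ K.- tq^ a))
    (maxRank≡M shape)))
    (K.trans (K.*-congʳ (λ m → ℤ[q].reflexive ℤ[q].∑-def)) A*∏≈totalPathSum)
    where
    module K = ℤ[q][[t]]

-- The number of transitions

private
  length-cartesianProduct : {X Y : Set} (xs : List X) (ys : List Y) →
    length (cartesianProduct xs ys) ≡ length xs Nat.* length ys
  length-cartesianProduct []       ys = ≡.refl
  length-cartesianProduct (x ∷ xs) ys = ≡.trans (List.length-++ (map (x ,_) ys))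
    (≡.cong₂ Nat._+_ (List.length-map (x ,_) ys) (length-cartesianProduct xs ys))

-- The constant 6 counts 3 previous moves times 2 letters; discarding illegal moves only shortens
-- the list.
length-transitions : ∀ r b → length (transitions r b) ≤ 6 Nat.* ((b 1 ∸ 1) Nat.* length (F r b))
length-transitions r b = begin
  length (transitions r b)
    ≤⟨ List.length-filter _ (cartesianProduct (allFin M) (cartesianProduct (F r b) moves)) ⟩
  length (cartesianProduct (allFin M) (cartesianProduct (F r b) moves))
    ≡⟨ length-cartesianProduct (allFin M) _ ⟩
  length (allFin M) Nat.* length (cartesianProduct (F r b) moves)
    ≡⟨ ≡.cong₂ Nat._*_ (List.length-tabulate {n = M} id)
         (length-cartesianProduct (F r b) moves) ⟩
  M Nat.* (length (F r b) Nat.* 6)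
    ≡⟨ ℕ.*-assoc M (length (F r b)) 6 ⟨
  (M Nat.* length (F r b)) Nat.* 6
    ≡⟨ ℕ.*-comm (M Nat.* length (F r b)) 6 ⟩
  6 Nat.* (M Nat.* length (F r b)) ∎
  where
  open ℕ.≤-Reasoning
  M = b 1 ∸ 1
  moves = cartesianProduct previousMoves (L ∷ R ∷ [])

-- Comparison of enumerator, table and numerator

module _ {r : ℕ} {b : ℕ → ℕ} (shape : FerrersShape r b) where
  open FerrersShape shape
  open PathSums using (totalPathSum)
  private
    M = b 1 ∸ 1
    D = descentEnumerator r b
    module ℤ[u] = Sums (polynomials M)

  descentEnumerator≋totalPathSum : D ≋ totalPathSum (polynomials M) r b var
  descentEnumerator≋totalPathSum = ℤ[u].trans (ℤ[u].reflexive ℤ[u].∑-def)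
    (Words.∑-words r b (polynomials M) 1≤r i≤bᵢ var)

  descentEnumerator≋result : D ≋ Recursion.result (polyRing M) r b var
  descentEnumerator≋result = ℤ[u].trans descentEnumerator≋totalPathSum
    (ℤ[u].sym (DynamicProgramming.result≈totalPathSum (polynomials M) r b var 1≤r i≤bᵢ))

  private
    -- The common value: the enumerator is carried to it by substitution, the table over ℤ[q,t]
    -- computes it, and it is carried to the numerator by expansion in t.
    tqPathSum : Poly 2
    tqPathSum = totalPathSum (polynomials 2) r b (tqPower {M})

  substitute≋tqPathSum : substitute tqPower D ≋ tqPathSum
  substitute≋tqPathSum = ℤ[q,t].trans (substitute-cong tqPower descentEnumerator≋totalPathSum)
    (PathSumHomomorphism.totalPathSum-homo (polynomials M) (polynomials 2) r b
      (substitute tqPower) (substitute-cong tqPower) (substitute-++ (tqPower {M})) ℤ[q,t].refl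
      (substitute-1# (tqPower {M})) {M} var tqPower (substitute-*-var tqPower))

  numerator≈tqPathSum : qZetaNumerator r b ℤ[q][[t]].≈ toSeries tqPathSum
  numerator≈tqPathSum = ℤ[q][[t]].trans (numerator≈totalPathSum shape) (ℤ[q][[t]].sym
    (PathSumHomomorphism.totalPathSum-homo (polynomials 2) (Series.series (polynomials 1)) r b
      toSeries (λ {p} {p′} → toSeries-cong {p} {p′}) toSeries-++ (λ _ → ℤ[q].refl) toSeries-1#
      {M} tqPower (tq^ ∘ toℕ) (toSeries-*-tqPower shape)))
    where open Multichains (polynomials 1) (var zero) shape using (tq^)

  numerator≈substitute : qZetaNumerator r b ℤ[q][[t]].≈ toSeries (substitute tqPower D)
  numerator≈substitute = ℤ[q][[t]].trans numerator≈tqPathSum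
    (toSeries-cong {tqPathSum} {substitute tqPower D} (ℤ[q,t].sym substitute≋tqPathSum))

  -- Running the table with the weights t q^(j-1) from the start yields the numerator without first
  -- forming the multivariate enumerator.
  numerator≈result : qZetaNumerator r b ℤ[q][[t]].≈
    toSeries (Recursion.result (polyRing 2) r b tqPower)
  numerator≈result = ℤ[q][[t]].trans numerator≈tqPathSum
    (toSeries-cong {tqPathSum} {Recursion.result (polyRing 2) r b tqPower}
      (ℤ[q,t].sym (DynamicProgramming.result≈totalPathSum (polynomials 2) r b tqPower 1≤r
        i≤bᵢ)))

open Nat using (_*_)

proposition5p3 :
  Σ ℕ λ C →
  (r : ℕ) (b : ℕ → ℕ) →
  1 ≤ r →
  ((i : ℕ) → 1 ≤ i → i < r → b (suc i) ≤ b i) →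
  ((i : ℕ) → 1 ≤ i → i ≤ r → i ≤ b i) →
  let M = b 1 ∸ 1
      D = descentEnumerator r b
      ℍ = qZetaNumerator r b
      _≈ᵤ_ = RawRing._≈_ (polyRing M)
      _≈ₜ_ = RawRing._≈_ (seriesRing (polyRing 1))
      open Recursion (polyRing M) r b var using (G)
      open BigOps (polyRing M) using (∑)
  in
  (D ≈ᵤ ∑ previousMoves (λ σ → G (M , (1 , b 1) , σ))) ×
  (ℍ ≈ₜ toSeries (substitute tqPower D)) ×
  (ℍ ≈ₜ toSeries (Recursion.result (polyRing 2) r b tqPower)) ×
  (length (transitions r b) ≤ C * (M * length (F r b)))
proposition5p3 = 6 , λ r b 1≤r b-dec i≤bᵢ →
  let shape = record { 1≤r = 1≤r ; b-dec = b-dec ; i≤bᵢ = i≤bᵢ }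
  in ≋⇒≈ (descentEnumerator≋result shape)
   , (λ m → ≋⇒≈ (numerator≈substitute shape m))
   , (λ m → ≋⇒≈ (numerator≈result shape m))
   , length-transitions r b
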